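{- Let $n\ge 5$ be a prime such that the multiplicative group $\mathbb{Z}_n^*$ is generated by $\{ -1,2\}$. Let $X_n$ be the $2$-dimensional simplicial complex on vertex set $\mathbb{Z}_n$ with full $1$-skeleton (all vertices and all edges) whose $2$-faces are exactly the arithmetic progressions $\{a,a+d,a+2d\}$ of length $3$ in $\mathbb{Z}_n$ with difference $d\notin\{0,\pm1\}$. Then: (1) $X_n$ is $2$-collapsible, and hence the set of its $2$-faces is an almost-hypertree over every field; (2) over $\mathbb{Q}$ the shadow of (the set of $2$-faces of) $X_n$ is empty. Consequently, the complement of the set of $2$-faces of $X_n$ in $\binom{\mathbb{Z}_n}{3}$ is a perfect hypercut over $\mathbb{Q}$.
   Context: For a field $\mathbb{F}$ and $d\ge1$, let $\partial_d$ be the $\binom{n}{d}\times\binom{n}{d+1}$ boundary matrix over $\mathbb{F}$ of the complete complex on $n$ vertices (columns indexed by oriented $d$-simplices, $\partial(v_0,\dots,v_d)=\sum_i(-1)^i(v_0,\dots,\hat v_i,\dots,v_d)$). The rank of a set $S$ of $d$-simplices is the $\mathbb{F}$-rank of the corresponding columns; $S$ is acyclic if its rank equals $|S|$. A $d$-hypertree is a maximal acyclic set of $d$-simplices (it has $\binom{n-1}{d}$ elements); an almost-hypertree is an acyclic set of size $\binom{n-1}{d}-1$. The shadow of $S$ is the set of $d$-simplices $\sigma\notin S$ with $\mathrm{rank}(S\cup\{\sigma\})=\mathrm{rank}(S)$. A $d$-hypercut is an inclusion-minimal set of $d$-simplices meeting every $d$-hypertree. A $2$-dimensional hypercut on $n$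 vertices is perfect if it has $\binom{n}{3}-\binom{n-1}{2}+1$ faces. A $(d-1)$-face of a $d$-complex is exposed if it lies in exactly one $d$-face; an elementary collapse removes an exposed $(d-1)$-face together with the unique $d$-face containing it; a $d$-complex is $d$-collapsible if all its $d$-faces can be removed by a sequence of elementary collapses. -}

module Defs where

open import Level using (Level; _⊔_; suc)
open import Algebra.Bundles using (CommutativeRing)
open import Data.Bool using (Bool; true; false; _∧_; _∨_; not; if_then_else_)
open import Data.Nat as ℕ using (ℕ; zero; _∸_; _≤_; _≡ᵇ_; NonZero)
open import Data.Nat.DivMod using (_%_)
open import Data.Nat.Combinatorics using (_C_)
open import Data.Fin as Fin using (Fin; toℕ)
open import Data.List using (List; []; _∷_; concatMap; foldr)
open import Data.Bool.ListAction using (any)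
open import Data.List using (allFin)
open import Data.Product using (Σ; ∃; _×_; _,_)
open import Relation.Nullary using (¬_; yes; no)
open import Relation.Binary.PropositionalEquality using (_≡_)

record Field (c ℓ : Level) : Set (Level.suc (c ⊔ ℓ)) where
  field
    commutativeRing : CommutativeRing c ℓ
  open CommutativeRing commutativeRing public
  field
    0≉1     : ¬ (0# ≈ 1#)
    inverse : ∀ x → ¬ (x ≈ 0#) → ∃ λ y → (x * y) ≈ 1#

-- Simplices of the complete complex on vertex set Fin n.
-- An (unoriented) 2-simplex {a,b,c} is stored with a < b < c; its
-- orientation is (a,b,c).  An edge {a,b} is stored with a < b.

record Tri (n : ℕ) : Set where
  constructor tri
  field
    a b c : Fin n
    a<b   : a Fin.< b
    b<c   : b Fin.< c

record Edge (n : ℕ) : Set where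
  constructor edge
  field
    u v : Fin n
    u<v : u Fin.< v

module _ {n : ℕ} where

  eqF : Fin n → Fin n → Bool
  eqF x y = toℕ x ≡ᵇ toℕ y

  sameTri : Tri n → Tri n → Bool
  sameTri (tri a b c _ _) (tri a' b' c' _ _) = eqF a a' ∧ eqF b b' ∧ eqF c c'

  allTri : List (Tri n)
  allTri = concatMap (λ a → concatMap (λ b → concatMap (λ c → mk a b c)
             (allFin n)) (allFin n)) (allFin n)
    where
    mk : Fin n → Fin n → Fin n → List (Tri n)
    mk a b c with a Fin.<? b | b Fin.<? c
    ... | yes p | yes q = tri a b c p q ∷ []
    ... | _     | _     = []

  FaceSet : Set
  FaceSet = Tri n → Bool

  card : FaceSet → ℕ
  card S = foldr (λ t k → if S t then ℕ.suc k else k) 0 allTri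

  _⊆_ : FaceSet → FaceSet → Set
  T ⊆ S = ∀ t → T t ≡ true → S t ≡ true

  insert : Tri n → FaceSet → FaceSet
  insert σ S t = S t ∨ sameTri t σ

  remove : Tri n → FaceSet → FaceSet
  remove σ S t = S t ∧ not (sameTri t σ)

  complement : FaceSet → FaceSet
  complement S t = not (S t)

  edgeIn : Edge n → Tri n → Bool
  edgeIn (edge u v _) (tri a b c _ _) =
    (eqF u a ∧ eqF v b) ∨ (eqF u a ∧ eqF v c) ∨ (eqF u b ∧ eqF v c)

  -- 2-collapsibility (full 1-skeleton; only the 2-faces matter).
  -- An edge e is exposed in S if it lies in exactly one face t of S;
  -- the elementary collapse removes e together with t.

  data Collapsible : FaceSet → Set where
    done : ∀ {S} → (∀ t → S t ≡ false) → Collapsible S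
    step : ∀ {S} (e : Edge n) (t : Tri n) →
           S t ≡ true → edgeIn e t ≡ true →
           (∀ t' → S t' ≡ true → edgeIn e t' ≡ true → sameTri t' t ≡ true) →
           Collapsible (remove t S) → Collapsible S

  module Linear {c ℓ : Level} (R : CommutativeRing c ℓ) where
    open CommutativeRing R

    -- entry of ∂₂ in row e, column t:  ∂(a,b,c) = (b,c) - (a,c) + (a,b)
    bd : Tri n → Edge n → Carrier
    bd (tri a b c _ _) (edge u v _) =
      if eqF u b ∧ eqF v c then 1#
      else if eqF u a ∧ eqF v c then - 1#
      else if eqF u a ∧ eqF v b then 1#
      else 0#

    comb : (Tri n → Carrier) → Edge n → Carrier
    comb f e = foldr (λ t s → (f t * bd t e) + s) 0# allTri

    Independent : FaceSet → Set (c ⊔ ℓ)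
    Independent S = ∀ (f : Tri n → Carrier) →
      (∀ t → S t ≡ false → f t ≈ 0#) →
      (∀ e → comb f e ≈ 0#) →
      ∀ t → f t ≈ 0#

    HasRank : FaceSet → ℕ → Set (c ⊔ ℓ)
    HasRank S r =
      (Σ FaceSet λ T → T ⊆ S × Independent T × card T ≡ r) ×
      (∀ T → T ⊆ S → Independent T → card T ≤ r)

    Acyclic : FaceSet → Set (c ⊔ ℓ)
    Acyclic S = HasRank S (card S)

    Hypertree : FaceSet → Set (c ⊔ ℓ)
    Hypertree S = Acyclic S × (∀ σ → S σ ≡ false → ¬ Acyclic (insert σ S))

    AlmostHypertree : FaceSet → Set (c ⊔ ℓ)
    AlmostHypertree S = Acyclic S × card S ≡ ((n ∸ 1) C 2) ∸ 1

    InShadow : FaceSet → Tri n → Set (c ⊔ ℓ)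
    InShadow S σ = S σ ≡ false × ∃ λ r → HasRank S r × HasRank (insert σ S) r

    Meets : FaceSet → FaceSet → Set
    Meets H T = ∃ λ t → H t ≡ true × T t ≡ true

    MeetsAllHypertrees : FaceSet → Set (c ⊔ ℓ)
    MeetsAllHypertrees H = ∀ T → Hypertree T → Meets H T

    Hypercut : FaceSet → Set (c ⊔ ℓ)
    Hypercut H = MeetsAllHypertrees H ×
      (∀ H' → H' ⊆ H → MeetsAllHypertrees H' → ∀ t → H t ≡ H' t)

    PerfectHypercut : FaceSet → Set (c ⊔ ℓ)
    PerfectHypercut H = Hypercut H × card H ≡ (n C 3) ∸ ((n ∸ 1) C 2) ℕ.+ 1

-- The generation hypothesis: the submonoid of (ℤ_n)^* generated by
-- -1 = n-1 and 2 (in a finite group this is the generated subgroup).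

module _ (n : ℕ) .{{_ : NonZero n}} where

  data Gen : ℕ → Set where
    gen-one : Gen 1
    gen-neg : ∀ {x} → Gen x → Gen ((x ℕ.* (n ∸ 1)) % n)
    gen-two : ∀ {x} → Gen x → Gen ((x ℕ.* 2) % n)

  GeneratedByMinusOneTwo : Set
  GeneratedByMinusOneTwo = ∀ x → 1 ≤ x → x ℕ.< n → Gen x

  Xn : Tri n → Bool
  Xn (tri a b c _ _) =
    any (λ x → any (λ d → goodD (toℕ d) ∧ sameSet (toℕ x) (toℕ d)) (allFin n)) (allFin n)
    where
    goodD : ℕ → Bool
    goodD d = not (d ≡ᵇ 0) ∧ not (d ≡ᵇ 1) ∧ not (d ≡ᵇ (n ∸ 1))
    mem3 : ℕ → ℕ → ℕ → ℕ → Bool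
    mem3 v p q r = (v ≡ᵇ p) ∨ (v ≡ᵇ q) ∨ (v ≡ᵇ r)
    sameSet : ℕ → ℕ → Bool
    sameSet x d =
      let p = x % n ; q = (x ℕ.+ d) % n ; r = (x ℕ.+ 2 ℕ.* d) % n
          a' = toℕ a ; b' = toℕ b ; c' = toℕ c
      in mem3 a' p q r ∧ mem3 b' p q r ∧ mem3 c' p q r ∧
         mem3 p a' b' c' ∧ mem3 q a' b' c' ∧ mem3 r a' b' c'

{-# OPTIONS --safe #-}
module Submission where

-- Every nonzero residue d is plus or minus a power of two, so there is a signed power of two w(d)
-- of least absolute value with 2 w(d) ≡ d (mod n).  It satisfies w(-d) = -w(d), and w(2d) = 2 w(d)
-- except for d = ±1, where w(2d) = ±1.  Signed powers of two sum to zero in threes only as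
-- x + x - 2x, so w(b - a) + w(c - b) + w(a - c) vanishes exactly when {a, b, c} is a face of Xn:
-- the rational cochain w annihilates the boundary of every face and of no other triangle, whence
-- the shadow is empty.  The faces collapse in order of decreasing |w(step)|, each at its edge of
-- difference 2 * step.  That Xn has one face less than a hypertree follows from the bound
-- (n-1) C 2 on the rank and from the fact that every edge either is the long edge of a face or
-- has difference ±2.

open import Defs
open import Level using (Level)
open import Algebra.Bundles using (CommutativeMonoid; CommutativeRing)
open import Data.Bool as Bool using (Bool; true; false; _∧_; _∨_; not; T; T?; if_then_else_)
open import Data.Bool.ListAction using (any)
open import Data.Bool.Properties using (T-≡; ∨-zeroʳ)
open import Data.Empty using (⊥; ⊥-elim)
open import Data.Fin as Fin using (Fin; toℕ; zero; suc)
import Data.Fin.Properties as Fin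
open import Data.List using (List; []; _∷_; _++_; map; length; concatMap; foldr; allFin; filterᵇ)
open import Data.List.Membership.Propositional using (_∈_; lose)
open import Data.List.Membership.Propositional.Properties
  using (∈-∃++; ∈-++⁺ˡ; ∈-++⁺ʳ; ∈-++⁻; ∈-map⁺; ∈-map⁻; ∈-allFin; ∈-concatMap⁺; ∈-concatMap⁻; ∈-filter⁺)
open import Data.List.Properties using (length-map; length-++; length-tabulate)
open import Data.List.Relation.Unary.All as All using ([]; _∷_)
open import Data.List.Relation.Unary.AllPairs using ([]; _∷_)
open import Data.List.Relation.Unary.Any as Any using (Any; here; there)
open import Data.List.Relation.Unary.Any.Properties using (any⁺; any⁻)
open import Data.List.Relation.Unary.Unique.Propositional using (Unique)
import Data.List.Relation.Unary.Unique.Propositional.Properties as Unique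
open import Data.Nat as ℕ using (ℕ; zero; suc; _≤_; z≤n; s≤s; _≡ᵇ_; NonZero)
open import Data.Nat.Combinatorics using (_C_; nCk+nC[k+1]≡[n+1]C[k+1]; nC1≡n)
import Data.Nat.Divisibility as ℕ
open import Data.Nat.DivMod using (_%_; _/_; m≡m%n+[m/n]*n; m%n<n; m<n⇒m%n≡m)
open import Data.Nat.Primality using (Prime; euclidsLemma; prime⇒irreducible)
import Data.Nat.Properties as ℕ
open import Data.Product using (∃; _×_; _,_; proj₁; proj₂)
open import Data.Rational.Properties using (+-*-commutativeRing)
open import Data.Sum using (_⊎_; inj₁; inj₂; [_,_]′)
open import Function using (_∘_; Equivalence)
open import Relation.Binary.Definitions using (tri<; tri≈; tri>)
open import Relation.Binary.PropositionalEquality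
  using (_≡_; _≢_; refl; sym; trans; cong; cong₂; subst; subst₂; module ≡-Reasoning)
open import Relation.Nullary using (¬_; yes; no; Dec; does)
open import Relation.Nullary.Decidable using (map′)

-- The normalisation 2 w(d) ≡ d, rather than w(d) ≡ d, decides where doubling breaks. Listed by
-- least exponent, the nonzero differences up to sign form a chain ±2, ±4, ..., ±1 with weights ±1,
-- ±2, ±4, ...; doubling moves one place along it, except that ±1 returns to the start. Hence the
-- only step at which a progression fails to have weights x, x, -2x is ±1, the step that `Xn`
-- excludes. Modulo n the weights around any triangle sum to zero, since w(d) ≡ d / 2 and the
-- differences do. Over the field with n elements w would thus be a coboundary and detect nothing;
-- the information lies in the sum vanishing as an integer, which is why the weights are embedded in
-- the rationals. The faces are counted by a squeeze. Adding one triangle outside `Xn` preserves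
-- independence over the rationals, so |Xn| + 1 is at most (n-1) C 2; covering the edges by long
-- edges of faces and n further edges gives n C 2 ≤ |Xn| + n, the same bound from the other side.
-- Independence over an arbitrary field comes from the collapse alone, and the count, once made,
-- holds for every field.

private
  variable
    a b : Level
    A : Set a
    B : Set b

-- Lists without repetition.

unique-⊆⇒length≤ : {xs ys : List A} → Unique xs → (∀ {x} → x ∈ xs → x ∈ ys) →
                   length xs ℕ.≤ length ys
unique-⊆⇒length≤ {xs = []} [] sub = z≤n
unique-⊆⇒length≤ {xs = x ∷ xs} (x∉xs ∷ u) sub
  with ys₁ , ys₂ , refl ← ∈-∃++ (sub (here refl)) = begin
    suc (length xs)             ≤⟨ s≤s (unique-⊆⇒length≤ u shrink) ⟩
    suc (length (ys₁ ++ ys₂))   ≡⟨ cong suc (length-++ ys₁) ⟩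
    suc (length ys₁ ℕ.+ length ys₂) ≡⟨ ℕ.+-suc (length ys₁) (length ys₂) ⟨
    length ys₁ ℕ.+ suc (length ys₂) ≡⟨ length-++ ys₁ ⟨
    length (ys₁ ++ x ∷ ys₂)     ∎
  where
  open ℕ.≤-Reasoning
  shrink : ∀ {y} → y ∈ xs → y ∈ ys₁ ++ ys₂
  shrink y∈ with ∈-++⁻ ys₁ (sub (there y∈))
  ... | inj₁ p = ∈-++⁺ˡ p
  ... | inj₂ (here refl) = ⊥-elim (All.lookup x∉xs y∈ refl)
  ... | inj₂ (there p) = ∈-++⁺ʳ ys₁ p

unique-concatMap : {xs : List A} {f : A → List B} → Unique xs → (∀ x → Unique (f x)) →
                   (∀ {x y z} → z ∈ f x → z ∈ f y → x ≡ y) → Unique (concatMap f xs)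
unique-concatMap [] uf dis = []
unique-concatMap {xs = x ∷ xs} {f} (x∉xs ∷ u) uf dis =
  Unique.++⁺ (uf x) (unique-concatMap u uf dis) λ (p , q) → disj p (∈-concatMap⁻ f {xs} q)
  where
  disj : ∀ {z} → z ∈ f x → Any (λ y → z ∈ f y) xs → ⊥
  disj p q = All.lookupWith (λ x≢y z∈fy → x≢y (dis p z∈fy)) x∉xs q

-- Finite sums in a commutative monoid.

module _ {c ℓ} (M : CommutativeMonoid c ℓ) where
  open CommutativeMonoid M renaming (Carrier to K; refl to ≈-refl; trans to ≈-trans; sym to ≈-sym)

  fold : (A → K) → List A → K
  fold f = foldr (λ x s → f x ∙ s) ε

  fold-cong : {f g : A → K} (xs : List A) → (∀ x → x ∈ xs → f x ≈ g x) → fold f xs ≈ fold g xs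
  fold-cong [] p = ≈-refl
  fold-cong (x ∷ xs) p = ∙-cong (p x (here refl)) (fold-cong xs (λ y → p y ∘ there))

  fold-ε : {f : A → K} (xs : List A) → (∀ x → x ∈ xs → f x ≈ ε) → fold f xs ≈ ε
  fold-ε [] p = ≈-refl
  fold-ε (x ∷ xs) p =
    ≈-trans (∙-cong (p x (here refl)) (fold-ε xs (λ y → p y ∘ there))) (identityˡ ε)

  fold-single : {f : A → K} {xs : List A} {x : A} → Unique xs → x ∈ xs →
                (∀ y → y ≢ x → f y ≈ ε) → fold f xs ≈ f x
  fold-single {f = f} {x ∷ xs} (x∉xs ∷ u) (here refl) p =
    ≈-trans (∙-congˡ (fold-ε xs λ y y∈ → p y (All.lookup x∉xs y∈ ∘ sym))) (identityʳ (f x))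
  fold-single {f = f} {y ∷ xs} (y∉xs ∷ u) (there x∈) p =
    ≈-trans (∙-cong (p y (All.lookup y∉xs x∈)) (fold-single u x∈ p)) (identityˡ _)

  fold-∙ : (f g : A → K) (xs : List A) → fold (λ x → f x ∙ g x) xs ≈ fold f xs ∙ fold g xs
  fold-∙ f g [] = ≈-sym (identityˡ ε)
  fold-∙ f g (x ∷ xs) = begin
    (f x ∙ g x) ∙ fold (λ y → f y ∙ g y) xs      ≈⟨ ∙-congˡ (fold-∙ f g xs) ⟩
    (f x ∙ g x) ∙ (fold f xs ∙ fold g xs)        ≈⟨ interchange (f x) (g x) _ _ ⟩
    (f x ∙ fold f xs) ∙ (g x ∙ fold g xs)        ∎
    where
    open import Relation.Binary.Reasoning.Setoid setoid
    open import Algebra.Properties.CommutativeSemigroup commutativeSemigroup using (interchange)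

  fold-swap : (f : A → B → K) (xs : List A) (ys : List B) →
              fold (λ x → fold (f x) ys) xs ≈ fold (λ y → fold (λ x → f x y) xs) ys
  fold-swap f [] ys = ≈-sym (fold-ε ys λ _ _ → ≈-refl)
  fold-swap f (x ∷ xs) ys =
    ≈-trans (∙-congˡ (fold-swap f xs ys)) (≈-sym (fold-∙ (f x) _ ys))

-- Equality of simplices and the list of all triangles.

tri-≡ : ∀ {n} {s t : Tri n} → Tri.a s ≡ Tri.a t → Tri.b s ≡ Tri.b t → Tri.c s ≡ Tri.c t → s ≡ t
tri-≡ {s = tri a b c p q} {tri _ _ _ p' q'} refl refl refl =
  cong₂ (tri a b c) (ℕ.<-irrelevant p p') (ℕ.<-irrelevant q q')

edge-≡ : ∀ {n} {d e : Edge n} → Edge.u d ≡ Edge.u e → Edge.v d ≡ Edge.v e → d ≡ e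
edge-≡ {d = edge u v p} {edge _ _ p'} refl refl = cong (edge u v) (ℕ.<-irrelevant p p')

T⇒≡ : ∀ {x} → T x → x ≡ true
T⇒≡ = Equivalence.to T-≡

≡⇒T : ∀ {x} → x ≡ true → T x
≡⇒T = Equivalence.from T-≡

¬T⇒≡false : ∀ {x} → ¬ T x → x ≡ false
¬T⇒≡false {false} p = refl
¬T⇒≡false {true} p = ⊥-elim (p _)

∧-true⁻ : ∀ {x y} → x ∧ y ≡ true → x ≡ true × y ≡ true
∧-true⁻ {true} p = refl , p

∧-true⁺ : ∀ {x y} → x ≡ true → y ≡ true → x ∧ y ≡ true
∧-true⁺ refl p = p

∨-true⁻ : ∀ {x y} → x ∨ y ≡ true → x ≡ true ⊎ y ≡ true
∨-true⁻ {true} p = inj₁ refl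
∨-true⁻ {false} p = inj₂ p

true≢false : ∀ {x} → x ≡ true → x ≡ false → ⊥
true≢false refl ()

module _ {n : ℕ} where

  eqF⇒≡ : ∀ {x y : Fin n} → eqF x y ≡ true → x ≡ y
  eqF⇒≡ {x} {y} p = Fin.toℕ-injective (ℕ.≡ᵇ⇒≡ (toℕ x) (toℕ y) (≡⇒T p))

  eqF-∧ : ∀ (u x v y : Fin n) → eqF u x ∧ eqF v y ≡ true → u ≡ x × v ≡ y
  eqF-∧ u x v y p with q , r ← ∧-true⁻ {eqF u x} p = eqF⇒≡ q , eqF⇒≡ r

  eqF-refl : ∀ (x : Fin n) → eqF x x ≡ true
  eqF-refl x = T⇒≡ (ℕ.≡⇒≡ᵇ (toℕ x) (toℕ x) refl)

  eqF-≢ : ∀ {x y : Fin n} → x ≢ y → eqF x y ≡ false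
  eqF-≢ x≢y = ¬T⇒≡false (x≢y ∘ eqF⇒≡ ∘ T⇒≡)

  sameTri⇒≡ : ∀ (s t : Tri n) → sameTri s t ≡ true → s ≡ t
  sameTri⇒≡ s t p with pa , q ← ∧-true⁻ p with pb , pc ← ∧-true⁻ q =
    tri-≡ (eqF⇒≡ pa) (eqF⇒≡ pb) (eqF⇒≡ pc)

  sameTri-refl : ∀ (t : Tri n) → sameTri t t ≡ true
  sameTri-refl (tri a b c _ _) = ∧-true⁺ (eqF-refl a) (∧-true⁺ (eqF-refl b) (eqF-refl c))

  sameTri-≢ : ∀ (s t : Tri n) → s ≢ t → sameTri s t ≡ false
  sameTri-≢ s t s≢t = ¬T⇒≡false (s≢t ∘ sameTri⇒≡ s t ∘ T⇒≡)

  _≟ₜ_ : (s t : Tri n) → Dec (s ≡ t)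
  s ≟ₜ t with sameTri s t in eq
  ... | true = yes (sameTri⇒≡ s t eq)
  ... | false = no λ where refl → true≢false (sameTri-refl s) eq

  -- The underscores stand for the local function generating allTri, which can only be
  -- reached by unification; hence the uses precede the definitions.
  allTri-complete : ∀ (t : Tri n) → t ∈ allTri
  single-complete : ∀ a b c p q → tri a b c p q ∈ _
  allTri-complete (tri a b c p q) =
    ∈-concatMap⁺ _ (at a (∈-concatMap⁺ _ (at b (∈-concatMap⁺ _ (at c (single-complete a b c p q))))))
    where
    at : {P : Fin n → Set} (x : Fin n) → P x → Any P (allFin n)
    at x px = Any.map (λ where refl → px) (∈-allFin x)
  single-complete a b c p q with a Fin.<? b | b Fin.<? c
  ... | yes p' | yes q' = here (tri-≡ refl refl refl)
  ... | yes p' | no ¬q = ⊥-elim (¬q q)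
  ... | no ¬p | _ = ⊥-elim (¬p p)

  allTri-unique : Unique (allTri {n})
  single-unique : ∀ a b c → Unique _
  single-vertices : ∀ a b c {z} → z ∈ _ → Tri.a z ≡ a × Tri.b z ≡ b × Tri.c z ≡ c
  allTri-unique =
    unique-concatMap (Unique.allFin⁺ n)
      (λ a → unique-concatMap (Unique.allFin⁺ n)
        (λ b → unique-concatMap (Unique.allFin⁺ n) (single-unique a b)
          λ p q → trans (sym (proj₂ (proj₂ (single-vertices a b _ p))))
                        (proj₂ (proj₂ (single-vertices a b _ q))))
        λ p q → trans (sym (vb a p)) (vb a q))
      λ p q → trans (sym (va p)) (va q)
    where
    vb : ∀ a {b z} → z ∈ concatMap _ (allFin n) → Tri.b z ≡ b
    vb a {b} p with c , q ← Any.satisfied (∈-concatMap⁻ _ {allFin n} p) =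
      proj₁ (proj₂ (single-vertices a b c q))
    va : ∀ {a z} → z ∈ concatMap _ (allFin n) → Tri.a z ≡ a
    va {a} p with b , q ← Any.satisfied (∈-concatMap⁻ _ {allFin n} p)
      with c , r ← Any.satisfied (∈-concatMap⁻ _ {allFin n} q) = proj₁ (single-vertices a b c r)
  single-unique a b c with a Fin.<? b | b Fin.<? c
  ... | yes p' | yes q' = [] ∷ []
  ... | yes p' | no ¬q = []
  ... | no ¬p | _ = []
  single-vertices a b c p with a Fin.<? b | b Fin.<? c
  single-vertices a b c (here refl) | yes _ | yes _ = refl , refl , refl

-- Counting edges and triangles.

liftE : ∀ {n} → Edge n → Edge (suc n)
liftE (edge u v p) = edge (suc u) (suc v) (s≤s p)

edge₀ : ∀ {n} → Fin n → Edge (suc n)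
edge₀ v = edge zero (suc v) (s≤s z≤n)

-- The recursion separates the edges that avoid vertex 0 from those that contain it, so that the
-- length obeys Pascal's rule.
edges : ∀ n → List (Edge n)
edges zero = []
edges (suc n) = map liftE (edges n) ++ map edge₀ (allFin n)

edges-complete : ∀ {n} (e : Edge n) → e ∈ edges n
edges-complete {suc n} (edge zero (suc v) (s≤s z≤n)) = ∈-++⁺ʳ _ (∈-map⁺ edge₀ (∈-allFin v))
edges-complete {suc n} (edge (suc u) (suc v) (s≤s p)) =
  ∈-++⁺ˡ (∈-map⁺ liftE (edges-complete (edge u v p)))

edges-unique : ∀ n → Unique (edges n)
edges-unique zero = []
edges-unique (suc n) = Unique.++⁺
  (Unique.map⁺ (λ eq → edge-≡ (Fin.suc-injective (cong Edge.u eq)) (Fin.suc-injective (cong Edge.v eq)))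
    (edges-unique n))
  (Unique.map⁺ (λ eq → Fin.suc-injective (cong Edge.v eq)) (Unique.allFin⁺ n))
  λ (p , q) → disjoint p q
  where
  disjoint : ∀ {e} → e ∈ map liftE (edges n) → e ∈ map edge₀ (allFin n) → ⊥
  disjoint p q with _ , _ , refl ← ∈-map⁻ liftE p with _ , _ , () ← ∈-map⁻ edge₀ q

length-edges : ∀ n → length (edges n) ≡ n C 2
length-edges zero = refl
length-edges (suc n) = begin
  length (map liftE (edges n) ++ map edge₀ (allFin n))  ≡⟨ length-++ (map liftE (edges n)) ⟩
  length (map liftE (edges n)) ℕ.+ length (map edge₀ (allFin n))
    ≡⟨ cong₂ ℕ._+_ (length-map liftE (edges n))
                   (trans (length-map edge₀ (allFin n)) (length-tabulate {n = n} (λ x → x))) ⟩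
  length (edges n) ℕ.+ n    ≡⟨ cong₂ ℕ._+_ (length-edges n) (sym (nC1≡n n)) ⟩
  n C 2 ℕ.+ n C 1           ≡⟨ ℕ.+-comm (n C 2) (n C 1) ⟩
  n C 1 ℕ.+ n C 2           ≡⟨ nCk+nC[k+1]≡[n+1]C[k+1] n 1 ⟩
  suc n C 2                 ∎
  where open ≡-Reasoning

liftT : ∀ {n} → Tri n → Tri (suc n)
liftT (tri a b c p q) = tri (suc a) (suc b) (suc c) (s≤s p) (s≤s q)

cone : ∀ {n} → Edge n → Tri (suc n)
cone (edge u v p) = tri zero (suc u) (suc v) (s≤s z≤n) (s≤s p)

-- The triangles at vertex 0 are cones over the edges of the remaining vertices, which is Pascal's
-- rule one dimension higher. `length-allTri` carries the count over to `allTri`, whose nested loops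
-- do not display it.
tris : ∀ n → List (Tri n)
tris zero = []
tris (suc n) = map liftT (tris n) ++ map cone (edges n)

tris-complete : ∀ {n} (t : Tri n) → t ∈ tris n
tris-complete {suc n} (tri zero (suc b) (suc c) (s≤s z≤n) (s≤s q)) =
  ∈-++⁺ʳ _ (∈-map⁺ cone (edges-complete (edge b c q)))
tris-complete {suc n} (tri (suc a) (suc b) (suc c) (s≤s p) (s≤s q)) =
  ∈-++⁺ˡ (∈-map⁺ liftT (tris-complete (tri a b c p q)))

tris-unique : ∀ n → Unique (tris n)
tris-unique zero = []
tris-unique (suc n) = Unique.++⁺
  (Unique.map⁺ (λ eq → tri-≡ (Fin.suc-injective (cong Tri.a eq)) (Fin.suc-injective (cong Tri.b eq))
                             (Fin.suc-injective (cong Tri.c eq)))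
    (tris-unique n))
  (Unique.map⁺ (λ eq → edge-≡ (Fin.suc-injective (cong Tri.b eq)) (Fin.suc-injective (cong Tri.c eq)))
    (edges-unique n))
  λ (p , q) → disjoint p q
  where
  disjoint : ∀ {t} → t ∈ map liftT (tris n) → t ∈ map cone (edges n) → ⊥
  disjoint p q with _ , _ , refl ← ∈-map⁻ liftT p with _ , _ , () ← ∈-map⁻ cone q

length-tris : ∀ n → length (tris n) ≡ n C 3
length-tris zero = refl
length-tris (suc n) = begin
  length (map liftT (tris n) ++ map cone (edges n))  ≡⟨ length-++ (map liftT (tris n)) ⟩
  length (map liftT (tris n)) ℕ.+ length (map cone (edges n))
    ≡⟨ cong₂ ℕ._+_ (length-map liftT (tris n)) (length-map cone (edges n)) ⟩
  length (tris n) ℕ.+ length (edges n)    ≡⟨ cong₂ ℕ._+_ (length-tris n) (length-edges n) ⟩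
  n C 3 ℕ.+ n C 2           ≡⟨ ℕ.+-comm (n C 3) (n C 2) ⟩
  n C 2 ℕ.+ n C 3           ≡⟨ nCk+nC[k+1]≡[n+1]C[k+1] n 2 ⟩
  suc n C 3                 ∎
  where open ≡-Reasoning

length-allTri : ∀ n → length (allTri {n}) ≡ n C 3
length-allTri n = trans (ℕ.≤-antisym
  (unique-⊆⇒length≤ (allTri-unique {n}) (λ {t} _ → tris-complete t))
  (unique-⊆⇒length≤ (tris-unique n) (λ {t} _ → allTri-complete {n} t))) (length-tris n)

-- Cardinalities of face sets.

module _ {n : ℕ} where

  indicator : FaceSet {n} → Tri n → ℕ
  indicator S t = if S t then 1 else 0

  count : FaceSet {n} → List (Tri n) → ℕ
  count S = fold ℕ.+-0-commutativeMonoid (indicator S)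

  card≡count : ∀ S → card {n} S ≡ count S allTri
  card≡count S = go allTri
    where
    go : ∀ ts → foldr (λ t k → if S t then suc k else k) 0 ts ≡ count S ts
    go [] = refl
    go (t ∷ ts) with S t
    ... | true = cong suc (go ts)
    ... | false = go ts

  search : (S : FaceSet {n}) → (∃ λ t → S t ≡ true) ⊎ (∀ t → S t ≡ false)
  search S with Any.any? (λ t → S t Bool.≟ true) allTri
  ... | yes p = inj₁ (Any.satisfied p)
  ... | no ¬p = inj₂ λ t → ¬T⇒≡false λ p → ¬p (lose (allTri-complete t) (T⇒≡ p))

  card-empty : ∀ {S} → (∀ t → S t ≡ false) → card {n} S ≡ 0
  card-empty {S} p = trans (card≡count S)
    (fold-ε ℕ.+-0-commutativeMonoid allTri λ t _ → cong (if_then 1 else 0) (p t))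

  insert-⊇ : ∀ (S : FaceSet {n}) σ → S ⊆ insert σ S
  insert-⊇ S σ t p rewrite p = refl

  insert-self : ∀ (S : FaceSet {n}) σ → insert σ S σ ≡ true
  insert-self S σ with S σ
  ... | true = refl
  ... | false = sameTri-refl σ

  insert⁻ : ∀ (S : FaceSet {n}) σ t → insert σ S t ≡ true → S t ≡ true ⊎ t ≡ σ
  insert⁻ S σ t p with ∨-true⁻ p
  ... | inj₁ q = inj₁ q
  ... | inj₂ q = inj₂ (sameTri⇒≡ t σ q)

  card-insert : ∀ (S : FaceSet {n}) σ → S σ ≡ false → card (insert σ S) ≡ suc (card S)
  card-insert S σ Sσ = begin
    card (insert σ S)                             ≡⟨ card≡count (insert σ S) ⟩
    count (insert σ S) allTri
      ≡⟨ fold-cong M {g = λ t → indicator (λ s → sameTri s σ) t ℕ.+ indicator S t} allTri (λ t _ → split t) ⟩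
    fold M (λ t → indicator (λ s → sameTri s σ) t ℕ.+ indicator S t) allTri
      ≡⟨ fold-∙ M (indicator (λ s → sameTri s σ)) (indicator S) (allTri {n}) ⟩
    count (λ s → sameTri s σ) allTri ℕ.+ count S allTri
      ≡⟨ cong₂ ℕ._+_ (trans one (cong (if_then 1 else 0) (sameTri-refl σ))) (sym (card≡count S)) ⟩
    suc (card S)                                  ∎
    where
    open ≡-Reasoning
    M = ℕ.+-0-commutativeMonoid
    split : ∀ t → indicator (insert σ S) t ≡ indicator (λ s → sameTri s σ) t ℕ.+ indicator S t
    split t with sameTri t σ in eq
    ... | true rewrite sameTri⇒≡ t σ eq | Sσ = refl
    ... | false with S t
    ...   | true = refl
    ...   | false = refl
    one : count (λ s → sameTri s σ) allTri ≡ indicator (λ s → sameTri s σ) σ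
    one = fold-single M allTri-unique (allTri-complete σ) λ t t≢σ →
      cong (if_then 1 else 0) (sameTri-≢ t σ t≢σ)

  card-mono : ∀ {T S : FaceSet {n}} → T ⊆ S → card T ℕ.≤ card S
  card-mono {T} {S} T⊆S rewrite card≡count T | card≡count S = go allTri
    where
    le : ∀ t → indicator T t ℕ.≤ indicator S t
    le t with T t in eq
    ... | false = z≤n
    ... | true rewrite T⊆S t eq = s≤s z≤n
    go : ∀ ts → count T ts ℕ.≤ count S ts
    go [] = z≤n
    go (t ∷ ts) = ℕ.+-mono-≤ (le t) (go ts)

  -- A face of `S` missing from `T` could be inserted into `T`, producing a subset of `S` with more
  -- faces than `S` has.
  card-≡⇒⊇ : ∀ {T S : FaceSet {n}} → T ⊆ S → card S ℕ.≤ card T → S ⊆ T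
  card-≡⇒⊇ {T} {S} T⊆S le t St with T t in eq
  ... | true = refl
  ... | false = ⊥-elim (ℕ.<-irrefl refl (begin-strict
      card T             <⟨ ℕ.n<1+n _ ⟩
      suc (card T)       ≡⟨ card-insert T t eq ⟨
      card (insert t T)  ≤⟨ card-mono insert⊆S ⟩
      card S             ≤⟨ le ⟩
      card T             ∎))
    where
    open ℕ.≤-Reasoning
    insert⊆S : insert t T ⊆ S
    insert⊆S s p with insert⁻ T t s p
    ... | inj₁ q = T⊆S s q
    ... | inj₂ refl = St

  remove-⊆ : ∀ (S : FaceSet {n}) t → remove t S ⊆ S
  remove-⊆ S t s p = proj₁ (∧-true⁻ p)

  remove-self : ∀ (S : FaceSet {n}) t → remove t S t ≡ false
  remove-self S t rewrite sameTri-refl t with S t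
  ... | true = refl
  ... | false = refl

  remove-≢ : ∀ (S : FaceSet {n}) s t → s ≢ t → S s ≡ true → remove t S s ≡ true
  remove-≢ S s t s≢t p rewrite p | sameTri-≢ s t s≢t = refl

  card-remove : ∀ (S : FaceSet {n}) t → S t ≡ true → suc (card (remove t S)) ≡ card S
  card-remove S t St = trans (sym (card-insert (remove t S) t (remove-self S t)))
    (ℕ.≤-antisym (card-mono incl) (card-mono incl'))
    where
    incl : insert t (remove t S) ⊆ S
    incl s p with insert⁻ (remove t S) t s p
    ... | inj₁ q = remove-⊆ S t s q
    ... | inj₂ refl = St
    incl' : S ⊆ insert t (remove t S)
    incl' s p with s ≟ₜ t
    ... | yes refl = insert-self (remove t S) s
    ... | no s≢t = insert-⊇ (remove t S) t s (remove-≢ S s t s≢t p)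

  card-complement : ∀ S → card {n} S ℕ.+ card (complement S) ≡ length (allTri {n})
  card-complement S rewrite card≡count S | card≡count (complement S) =
    trans (sym (fold-∙ ℕ.+-0-commutativeMonoid (indicator S) (indicator (complement S)) (allTri {n})))
      (go (allTri {n}))
    where
    go : ∀ ts → fold ℕ.+-0-commutativeMonoid (λ t → indicator S t ℕ.+ indicator (complement S) t) ts
              ≡ length ts
    go [] = refl
    go (t ∷ ts) with S t
    ... | true = cong suc (go ts)
    ... | false = cong suc (go ts)

module _ where
  open import Data.Nat.Solver using (module +-*-Solver)
  open +-*-Solver

  sum-reverse : ∀ x y z → z ℕ.+ y ℕ.+ x ≡ x ℕ.+ y ℕ.+ z
  sum-reverse = solve 3 (λ x y z → z :+ y :+ x := x :+ y :+ z) refl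

  sum-rotate : ∀ x y z → z ℕ.+ x ℕ.+ y ≡ x ℕ.+ y ℕ.+ z
  sum-rotate = solve 3 (λ x y z → z :+ x :+ y := x :+ y :+ z) refl

  long-sum : ∀ {r x y z} → r ≡ x ℕ.+ y ℕ.+ z → x ≡ suc z → y ≡ z → 2 ℕ.+ r ≡ 3 ℕ.* x
  long-sum {z = z} refl refl refl =
    solve 1 (λ k → con 2 :+ (con 1 :+ k :+ k :+ k) := con 3 :* (con 1 :+ k)) refl z

  short-sum : ∀ {r x y z} → r ≡ x ℕ.+ y ℕ.+ z → y ≡ x → z ≡ suc x → r ≡ 1 ℕ.+ 3 ℕ.* x
  short-sum {x = x} refl refl refl =
    solve 1 (λ k → k :+ k :+ (con 1 :+ k) := con 1 :+ con 3 :* k) refl x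

  short-sum′ : ∀ {r x y z} → r ≡ x ℕ.+ y ℕ.+ z → y ≡ suc x → z ≡ x → r ≡ 1 ℕ.+ 3 ℕ.* x
  short-sum′ {x = x} refl refl refl =
    solve 1 (λ k → k :+ (con 1 :+ k) :+ k := con 1 :+ con 3 :* k) refl x


-- Triangles through an edge, and collapsing by rank.

data Spans {n} (u v z : Fin n) : Tri n → Set where
  spans-ab   : ∀ p q → Spans u v z (tri u v z p q)
  spans-ac : ∀ p q → Spans u v z (tri u z v p q)
  spans-bc  : ∀ p q → Spans u v z (tri z u v p q)

module _ {n : ℕ} where

  spans-unique : ∀ {u v z} {s t : Tri n} → Spans u v z s → Spans u v z t → s ≡ t
  spans-unique (spans-ab _ _) (spans-ab _ _) = tri-≡ refl refl refl
  spans-unique (spans-ab p q) (spans-ac p' q') = ⊥-elim (ℕ.<-asym q q')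
  spans-unique (spans-ab p q) (spans-bc p' q') = ⊥-elim (ℕ.<-asym (ℕ.<-trans p q) p')
  spans-unique (spans-ac p q) (spans-ab p' q') = ⊥-elim (ℕ.<-asym q q')
  spans-unique (spans-ac _ _) (spans-ac _ _) = tri-≡ refl refl refl
  spans-unique (spans-ac p q) (spans-bc p' q') = ⊥-elim (ℕ.<-asym p p')
  spans-unique (spans-bc p q) (spans-ab p' q') = ⊥-elim (ℕ.<-asym (ℕ.<-trans p q) q')
  spans-unique (spans-bc p q) (spans-ac p' q') = ⊥-elim (ℕ.<-asym p p')
  spans-unique (spans-bc _ _) (spans-bc _ _) = tri-≡ refl refl refl

  edgeIn⇒spans : ∀ {u v u<v} (t : Tri n) → edgeIn (edge u v u<v) t ≡ true → ∃ λ z → Spans u v z t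
  edgeIn⇒spans {u} {v} (tri a b c p q) e with ∨-true⁻ {eqF u a ∧ eqF v b} e
  ... | inj₁ ab with refl , refl ← eqF-∧ u a v b ab = c , spans-ab p q
  ... | inj₂ e' with ∨-true⁻ {eqF u a ∧ eqF v c} e'
  ...   | inj₁ ac with refl , refl ← eqF-∧ u a v c ac = b , spans-ac p q
  ...   | inj₂ bc with refl , refl ← eqF-∧ u b v c bc = a , spans-bc p q

  spans⇒edgeIn : ∀ {u v z u<v} {t : Tri n} → Spans u v z t → edgeIn (edge u v u<v) t ≡ true
  spans⇒edgeIn {u} {v} (spans-ab _ _) rewrite eqF-refl u | eqF-refl v = refl
  spans⇒edgeIn {u} {v} {z} (spans-ac _ _) rewrite eqF-refl u | eqF-refl v = ∨-zeroʳ (eqF v z)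
  spans⇒edgeIn {u} {v} {z} (spans-bc _ _)
    rewrite eqF-refl u | eqF-refl v | ∨-zeroʳ (eqF u z ∧ true) = ∨-zeroʳ (eqF u z ∧ eqF v u)

  span : ∀ {u v z : Fin n} → u Fin.< v → z ≢ u → z ≢ v → ∃ (Spans u v z)
  span {u} {v} {z} u<v z≢u z≢v with Fin.<-cmp z u | Fin.<-cmp z v
  ... | tri< z<u _ _ | _ = _ , spans-bc z<u u<v
  ... | tri≈ _ z≡u _ | _ = ⊥-elim (z≢u z≡u)
  ... | tri> _ _ u<z | tri< z<v _ _ = _ , spans-ac u<z z<v
  ... | tri> _ _ u<z | tri≈ _ z≡v _ = ⊥-elim (z≢v z≡v)
  ... | tri> _ _ u<z | tri> _ _ v<z = _ , spans-ab u<v v<z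

  sortEdge : (x y : Fin n) → x ≢ y → Edge n
  sortEdge x y x≢y with Fin.<-cmp x y
  ... | tri< x<y _ _ = edge x y x<y
  ... | tri≈ _ x≡y _ = ⊥-elim (x≢y x≡y)
  ... | tri> _ _ y<x = edge y x y<x

  sortEdge-< : ∀ {x y u v} x≢y (u<v : u Fin.< v) → x ≡ u → y ≡ v → sortEdge x y x≢y ≡ edge u v u<v
  sortEdge-< {x} {y} x≢y u<v refl refl with Fin.<-cmp x y
  ... | tri< _ _ _ = edge-≡ refl refl
  ... | tri≈ ¬< _ _ = ⊥-elim (¬< u<v)
  ... | tri> ¬< _ _ = ⊥-elim (¬< u<v)

  sortEdge-> : ∀ {x y u v} x≢y (u<v : u Fin.< v) → x ≡ v → y ≡ u → sortEdge x y x≢y ≡ edge u v u<v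
  sortEdge-> {x} {y} x≢y u<v refl refl with Fin.<-cmp x y
  ... | tri> _ _ _ = edge-≡ refl refl
  ... | tri≈ _ _ ¬> = ⊥-elim (¬> u<v)
  ... | tri< _ _ ¬> = ⊥-elim (¬> u<v)

  maximum : (S : FaceSet {n}) (f : Tri n → ℕ) → (∀ t → S t ≡ false) ⊎
            (∃ λ t → S t ≡ true × (∀ s → S s ≡ true → f s ℕ.≤ f t))
  maximum S f with go allTri
    where
    go : ∀ ts → (∀ t → t ∈ ts → S t ≡ false) ⊎
         (∃ λ t → S t ≡ true × (∀ s → s ∈ ts → S s ≡ true → f s ℕ.≤ f t))
    go [] = inj₁ λ _ ()
    go (t ∷ ts) with S t in St | go ts
    ... | false | inj₁ none = inj₁ λ where
            _ (here refl) → St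
            s (there s∈) → none s s∈
    ... | false | inj₂ (m , Sm , max) = inj₂ (m , Sm , λ where
            _ (here refl) St' → ⊥-elim (true≢false St' St)
            s (there s∈) → max s s∈)
    ... | true | inj₁ none = inj₂ (t , St , λ where
            _ (here refl) _ → ℕ.≤-refl
            s (there s∈) Ss → ⊥-elim (true≢false Ss (none s s∈)))
    ... | true | inj₂ (m , Sm , max) with ℕ.≤-total (f t) (f m)
    ...   | inj₁ ft≤fm = inj₂ (m , Sm , λ where
            _ (here refl) _ → ft≤fm
            s (there s∈) → max s s∈)
    ...   | inj₂ fm≤ft = inj₂ (t , St , λ where
            _ (here refl) _ → ℕ.≤-refl
            s (there s∈) Ss → ℕ.≤-trans (max s s∈ Ss) fm≤ft)
  ... | inj₁ none = inj₁ λ t → none t (allTri-complete t)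
  ... | inj₂ (t , St , max) = inj₂ (t , St , λ s → max s (allTri-complete s))

  length-filter≡card : (S : FaceSet {n}) → length (filterᵇ S allTri) ≡ card S
  length-filter≡card S = go allTri
    where
    go : ∀ ts → length (filterᵇ S ts) ≡ foldr (λ t k → if S t then suc k else k) 0 ts
    go [] = refl
    go (t ∷ ts) with S t
    ... | true = cong suc (go ts)
    ... | false = go ts

  -- Faces are removed in order of decreasing rank. When `t` is of maximal rank among the survivors,
  -- any other face at its edge `e` would have rank at most that of `t`, and the hypothesis forbids
  -- such a face; so `e` is exposed.
  collapsible-by-rank : (X : FaceSet {n}) (rank : Tri n → ℕ) →
    (∀ t → X t ≡ true → ∃ λ e → edgeIn e t ≡ true ×
      (∀ s → X s ≡ true → edgeIn e s ≡ true → rank s ℕ.≤ rank t → s ≡ t)) →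
    Collapsible X
  collapsible-by-rank X rank free = go (card X) X refl λ _ p → p
    where
    go : ∀ k S → card S ≡ k → S ⊆ X → Collapsible S
    go k S size S⊆X with maximum S rank
    ... | inj₁ empty = done empty
    go zero S size S⊆X | inj₂ (t , St , _) with () ← trans (card-remove S t St) size
    go (suc k) S size S⊆X | inj₂ (t , St , max) with e , e∈t , unique ← free t (S⊆X t St) =
      step e t St e∈t
        (λ s Ss e∈s → subst (λ s → sameTri s t ≡ true) (sym (unique s (S⊆X s Ss) e∈s (max s Ss))) (sameTri-refl t))
        (go k (remove t S) (ℕ.suc-injective (trans (card-remove S t St) size)) λ s p → S⊆X s (remove-⊆ S t s p))

-- Boundary, coboundary and independence over a commutative ring.

module _ {n : ℕ} {c ℓ : Level} (R : CommutativeRing c ℓ) where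
  open CommutativeRing R
    using (Carrier; _≈_; 0#; 1#; _*_; +-commutativeMonoid; setoid; zeroˡ; zeroʳ; distribˡ; -‿cong;
           +-cong; +-congˡ; +-identityˡ; +-identityʳ; *-congˡ; *-congʳ; *-identityʳ; *-assoc; *-comm)
    renaming (_+_ to _⊕_; -_ to ⊖_; refl to ≈-refl; sym to ≈-sym; trans to ≈-trans; reflexive to ≈-reflexive)
  open import Algebra.Properties.Ring (CommutativeRing.ring R) using (-‿distribʳ-*; -‿involutive; -0#≈0#)
  open Linear {n} R

  bd-outside : ∀ e t → edgeIn e t ≡ false → bd t e ≡ 0#
  bd-outside (edge u v _) (tri a b c _ _) p
    with eqF u a ∧ eqF v b | eqF u a ∧ eqF v c | eqF u b ∧ eqF v c
  ... | false | false | false = refl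

  bd-inside : ∀ e t → edgeIn e t ≡ true → bd t e ≡ 1# ⊎ bd t e ≡ ⊖ 1#
  bd-inside (edge u v _) (tri a b c _ _) p
    with eqF u a ∧ eqF v b | eqF u a ∧ eqF v c | eqF u b ∧ eqF v c
  ... | _     | _     | true  = inj₁ refl
  ... | _     | true  | false = inj₂ refl
  ... | true  | false | false = inj₁ refl

  cancel-±1 : ∀ {x y} → y ≡ 1# ⊎ y ≡ ⊖ 1# → x * y ≈ 0# → x ≈ 0#
  cancel-±1 (inj₁ refl) p = ≈-trans (≈-sym (*-identityʳ _)) p
  cancel-±1 {x} (inj₂ refl) p = begin
    x               ≈⟨ -‿involutive x ⟨
    ⊖ (⊖ x)         ≈⟨ -‿cong (-‿cong (*-identityʳ x)) ⟨
    ⊖ (⊖ (x * 1#))  ≈⟨ -‿cong (-‿distribʳ-* x 1#) ⟩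
    ⊖ (x * ⊖ 1#)    ≈⟨ -‿cong p ⟩
    ⊖ 0#            ≈⟨ -0#≈0# ⟩
    0#              ∎
    where
    open import Relation.Binary.Reasoning.Setoid setoid

  independent-⊆ : ∀ {T S} → T ⊆ S → Independent S → Independent T
  independent-⊆ {T} {S} T⊆S indep f supp = indep f λ t St → supp t (outside t St)
    where
    outside : ∀ t → S t ≡ false → T t ≡ false
    outside t St = ¬T⇒≡false λ p → true≢false (T⊆S t (T⇒≡ p)) St

  -- In the row of the exposed edge only the face `s` contributes, with entry 1 or -1. A cycle
  -- therefore vanishes at `s` and is a cycle on what remains after the collapse.
  collapsible⇒independent : ∀ {S} → Collapsible S → Independent S
  collapsible⇒independent (done empty) f supp cyc t = supp t (empty t)
  collapsible⇒independent {S} (step e s Ss e∈s exposed rest) f supp cyc =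
    collapsible⇒independent rest f supp' cyc
    where
    others : ∀ t → t ≢ s → f t * bd t e ≈ 0#
    others t t≢s with S t in St
    ... | false = ≈-trans (*-congʳ (supp t St)) (zeroˡ _)
    ... | true = ≈-trans (*-congˡ (≈-reflexive (bd-outside e t (¬T⇒≡false λ p →
            t≢s (sameTri⇒≡ t s (exposed t St (T⇒≡ p))))))) (zeroʳ _)
    fs : f s ≈ 0#
    fs = cancel-±1 (bd-inside e s e∈s) (≈-trans
      (≈-sym (fold-single +-commutativeMonoid {f = λ t → f t * bd t e} allTri-unique (allTri-complete s) others))
      (cyc e))
    supp' : ∀ t → remove s S t ≡ false → f t ≈ 0#
    supp' t p with t ≟ₜ s
    ... | yes refl = fs
    ... | no t≢s = supp t (¬T⇒≡false λ q → true≢false (remove-≢ S t s t≢s (T⇒≡ q)) p)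

  independent⇒acyclic : ∀ {S} → Independent S → Acyclic S
  independent⇒acyclic {S} indep = (S , (λ _ p → p) , indep , refl) , λ T T⊆S _ → card-mono T⊆S

  acyclic⇒independent : ∀ {S} → Acyclic S → Independent S
  acyclic⇒independent {S} ((T , T⊆S , indep , eq) , _) =
    independent-⊆ (card-≡⇒⊇ T⊆S (ℕ.≤-reflexive (sym eq))) indep

  -- The rank of the enlarged set is at least `card S` + 1, whereas no subset of `S` is that large.
  independent-insert⇒¬shadow : ∀ {S σ} → Independent (insert σ S) → ¬ InShadow S σ
  independent-insert⇒¬shadow {S} {σ} indep (Sσ , r , ((T , T⊆S , _ , eq) , _) , (_ , bound)) =
    ℕ.<-irrefl refl (begin-strict
      card S             <⟨ ℕ.n<1+n _ ⟩
      suc (card S)       ≡⟨ card-insert S σ Sσ ⟨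
      card (insert σ S)  ≤⟨ bound (insert σ S) (λ _ p → p) indep ⟩
      r                  ≡⟨ eq ⟨
      card T             ≤⟨ card-mono T⊆S ⟩
      card S             ∎)
    where open ℕ.≤-Reasoning

  private
    Σ[_] : {A : Set} → (A → Carrier) → List A → Carrier
    Σ[ f ] = fold +-commutativeMonoid f

  *-distribˡ-fold : {A : Set} (x : Carrier) (f : A → Carrier) (xs : List A) →
                    x * Σ[ f ] xs ≈ Σ[ (λ a → x * f a) ] xs
  *-distribˡ-fold x f [] = zeroʳ x
  *-distribˡ-fold x f (a ∷ xs) = ≈-trans (distribˡ x (f a) _) (+-congˡ (*-distribˡ-fold x f xs))

  -- The transpose of the boundary matrix, applied to a cochain on edges; `stokes` is the
  -- adjointness.
  coboundary : (Edge n → Carrier) → Tri n → Carrier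
  coboundary w (tri a b c p q) =
    w (edge b c q) ⊕ (⊖ w (edge a c (ℕ.<-trans p q)) ⊕ w (edge a b p))

  private
    at : Fin n → Fin n → Carrier → Edge n → Carrier
    at x y s (edge u v _) = if eqF u x ∧ eqF v y then s else 0#

    fold-at : ∀ (w : Edge n → Carrier) x y (p : x Fin.< y) s →
              Σ[ (λ e → w e * at x y s e) ] (edges n) ≈ w (edge x y p) * s
    fold-at w x y p s = ≈-trans
      (fold-single +-commutativeMonoid {f = λ e → w e * at x y s e}
        (edges-unique n) (edges-complete (edge x y p)) others)
      (*-congˡ (≈-reflexive at-self))
      where
      others : ∀ e → e ≢ edge x y p → w e * at x y s e ≈ 0#
      others e@(edge u v _) e≢ with eqF u x ∧ eqF v y in eq
      ... | false = zeroʳ (w e)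
      ... | true = ⊥-elim (e≢ (edge-≡ (proj₁ (eqF-∧ u x v y eq)) (proj₂ (eqF-∧ u x v y eq))))
      at-self : at x y s (edge x y p) ≡ s
      at-self rewrite eqF-refl x | eqF-refl y = refl

    -- The three tests nested in `bd` exclude one another because a < b < c. The entry is therefore
    -- a sum of three independent terms, which can be summed over the edges one at a time.
    bd-split : ∀ t e → bd t e ≈ at (Tri.b t) (Tri.c t) 1# e ⊕
                 (at (Tri.a t) (Tri.c t) (⊖ 1#) e ⊕ at (Tri.a t) (Tri.b t) 1# e)
    bd-split (tri a b c p q) (edge u v _)
      with eqF u b ∧ eqF v c in bc | eqF u a ∧ eqF v c in ac | eqF u a ∧ eqF v b in ab
    ... | true | true | _ = ⊥-elim (Fin.<-irrefl
            (trans (sym (proj₁ (eqF-∧ u a v c ac))) (proj₁ (eqF-∧ u b v c bc))) p)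
    ... | true | false | true = ⊥-elim (Fin.<-irrefl
            (trans (sym (proj₁ (eqF-∧ u a v b ab))) (proj₁ (eqF-∧ u b v c bc))) p)
    ... | false | true | true = ⊥-elim (Fin.<-irrefl
            (trans (sym (proj₂ (eqF-∧ u a v b ab))) (proj₂ (eqF-∧ u a v c ac))) q)
    ... | true | false | false = ≈-sym (≈-trans (+-congˡ (+-identityˡ 0#)) (+-identityʳ 1#))
    ... | false | true | false = ≈-sym (≈-trans (+-identityˡ _) (+-identityʳ (⊖ 1#)))
    ... | false | false | true = ≈-sym (≈-trans (+-identityˡ _) (+-identityˡ 1#))
    ... | false | false | false = ≈-sym (≈-trans (+-identityˡ _) (+-identityˡ 0#))

    open import Relation.Binary.Reasoning.Setoid setoid

    fold-bd : ∀ w t → Σ[ (λ e → w e * bd t e) ] (edges n) ≈ coboundary w t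
    fold-bd w t@(tri a b c p q) = begin
      Σ[ (λ e → w e * bd t e) ] (edges n)
        ≈⟨ fold-cong +-commutativeMonoid {f = λ e → w e * bd t e}
             {g = λ e → f₁ e ⊕ (f₂ e ⊕ f₃ e)} (edges n) (λ e _ → expand e) ⟩
      Σ[ (λ e → f₁ e ⊕ (f₂ e ⊕ f₃ e)) ] (edges n)
        ≈⟨ fold-∙ +-commutativeMonoid f₁ (λ e → f₂ e ⊕ f₃ e) (edges n) ⟩
      Σ[ f₁ ] (edges n) ⊕ Σ[ (λ e → f₂ e ⊕ f₃ e) ] (edges n)
        ≈⟨ +-congˡ (fold-∙ +-commutativeMonoid f₂ f₃ (edges n)) ⟩
      Σ[ f₁ ] (edges n) ⊕ (Σ[ f₂ ] (edges n) ⊕ Σ[ f₃ ] (edges n))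
        ≈⟨ +-cong (fold-at w b c q 1#) (+-cong (fold-at w a c (ℕ.<-trans p q) (⊖ 1#)) (fold-at w a b p 1#)) ⟩
      w _ * 1# ⊕ (w _ * ⊖ 1# ⊕ w _ * 1#)
        ≈⟨ +-cong (*-identityʳ _) (+-cong
             (≈-trans (≈-sym (-‿distribʳ-* _ 1#)) (-‿cong (*-identityʳ _))) (*-identityʳ _)) ⟩
      coboundary w t ∎
      where
      f₁ f₂ f₃ : Edge n → Carrier
      f₁ e = w e * at b c 1# e
      f₂ e = w e * at a c (⊖ 1#) e
      f₃ e = w e * at a b 1# e
      expand : ∀ e → w e * bd t e ≈ f₁ e ⊕ (f₂ e ⊕ f₃ e)
      expand e = ≈-trans (*-congˡ (bd-split t e)) (≈-trans (distribˡ _ _ _) (+-congˡ (distribˡ _ _ _)))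

  -- The double sum over edges and triangles is taken in the other order; the inner sum over edges
  -- then collects `w` on the boundary of a single triangle.
  stokes : ∀ w f → Σ[ (λ e → w e * comb f e) ] (edges n) ≈ Σ[ (λ t → f t * coboundary w t) ] allTri
  stokes w f = begin
    Σ[ (λ e → w e * comb f e) ] (edges n)
      ≈⟨ fold-cong +-commutativeMonoid (edges n) (λ e _ → *-distribˡ-fold (w e) (λ t → f t * bd t e) allTri) ⟩
    Σ[ (λ e → Σ[ (λ t → w e * (f t * bd t e)) ] allTri) ] (edges n)
      ≈⟨ fold-swap +-commutativeMonoid (λ e t → w e * (f t * bd t e)) (edges n) (allTri {n}) ⟩
    Σ[ (λ t → Σ[ (λ e → w e * (f t * bd t e)) ] (edges n)) ] allTri
      ≈⟨ fold-cong +-commutativeMonoid (allTri {n}) (λ t _ → inner t) ⟩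
    Σ[ (λ t → f t * coboundary w t) ] allTri ∎
    where
    exchange : ∀ x y z → x * (y * z) ≈ y * (x * z)
    exchange x y z = ≈-trans (≈-sym (*-assoc x y z)) (≈-trans (*-congʳ (*-comm x y)) (*-assoc y x z))
    inner : ∀ t → Σ[ (λ e → w e * (f t * bd t e)) ] (edges n) ≈ f t * coboundary w t
    inner t = begin
      Σ[ (λ e → w e * (f t * bd t e)) ] (edges n)
        ≈⟨ fold-cong +-commutativeMonoid (edges n) (λ e _ → exchange (w e) (f t) (bd t e)) ⟩
      Σ[ (λ e → f t * (w e * bd t e)) ] (edges n)
        ≈⟨ *-distribˡ-fold (f t) (λ e → w e * bd t e) (edges n) ⟨
      f t * Σ[ (λ e → w e * bd t e) ] (edges n)   ≈⟨ *-congˡ (fold-bd w t) ⟩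
      f t * coboundary w t                        ∎

  -- Pairing the cycle `f` with `w` gives zero by `stokes`. Faces of `S` drop out because the
  -- coboundary of `w` vanishes there, triangles outside `insert σ S` because `f` does; only the
  -- term at `σ` is left.
  cocycle-test : ∀ {S σ} w f → (∀ t → S t ≡ true → coboundary w t ≈ 0#) →
                 (∀ t → insert σ S t ≡ false → f t ≈ 0#) → (∀ e → comb f e ≈ 0#) →
                 f σ * coboundary w σ ≈ 0#
  cocycle-test {S} {σ} w f cocyc supp cyc = begin
    f σ * coboundary w σ
      ≈⟨ fold-single +-commutativeMonoid {f = λ t → f t * coboundary w t} allTri-unique (allTri-complete σ) others ⟨
    Σ[ (λ t → f t * coboundary w t) ] allTri  ≈⟨ stokes w f ⟨
    Σ[ (λ e → w e * comb f e) ] (edges n)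
      ≈⟨ fold-ε +-commutativeMonoid (edges n) (λ e _ → ≈-trans (*-congˡ (cyc e)) (zeroʳ (w e))) ⟩
    0# ∎
    where
    others : ∀ t → t ≢ σ → f t * coboundary w t ≈ 0#
    others t t≢σ with S t in St
    ... | true = ≈-trans (*-congˡ (cocyc t St)) (zeroʳ (f t))
    ... | false = ≈-trans (*-congʳ (supp t (¬T⇒≡false λ p → notin (insert⁻ S σ t (T⇒≡ p))))) (zeroˡ _)
      where
      notin : S t ≡ true ⊎ t ≡ σ → ⊥
      notin (inj₁ q) = true≢false q St
      notin (inj₂ q) = t≢σ q

-- Linear algebra over the rationals and the rank bound.

module Overℚ where
  open import Data.Rational using (ℚ; 0ℚ; 1ℚ; _+_; _*_; -_; _≟_; NonZero; ≢-nonZero; 1/_)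
  open import Data.Rational.Properties
  open import Data.Rational.Solver using (module +-*-Solver)

  private
    R = +-*-commutativeRing
    open module L {n} = Linear {n} R

  Σ[_] : {A : Set} → (A → ℚ) → List A → ℚ
  Σ[ f ] = fold +-0-commutativeMonoid f

  *-cancel-≢0 : ∀ {x y} → y ≢ 0ℚ → x * y ≡ 0ℚ → x ≡ 0ℚ
  *-cancel-≢0 {x} {y} y≢0 eq = *-cancelʳ-nonZero
    where
    instance _ = ≢-nonZero y≢0
    *-cancelʳ-nonZero : x ≡ 0ℚ
    *-cancelʳ-nonZero = begin
      x               ≡⟨ *-identityʳ x ⟨
      x * 1ℚ          ≡⟨ cong (x *_) (*-inverseʳ y) ⟨
      x * (y * 1/ y)  ≡⟨ *-assoc x y (1/ y) ⟨
      x * y * 1/ y    ≡⟨ cong (_* 1/ y) eq ⟩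
      0ℚ * 1/ y       ≡⟨ *-zeroˡ (1/ y) ⟩
      0ℚ              ∎
      where open ≡-Reasoning

  -- `cocycle-test` leaves a product whose second factor is nonzero, so a cycle on the enlarged set
  -- has coefficient zero at `σ` and is already a cycle on `S`.
  independent-insert : ∀ {n} {S : FaceSet {n}} {σ} (w : Edge n → ℚ) → Independent S →
    (∀ t → S t ≡ true → coboundary R w t ≡ 0ℚ) → coboundary R w σ ≢ 0ℚ → Independent (insert σ S)
  independent-insert {S = S} {σ} w indep cocyc w≢0 f supp cyc = indep f supp' cyc
    where
    fσ : f σ ≡ 0ℚ
    fσ = *-cancel-≢0 w≢0 (cocycle-test R {S} {σ} w f cocyc supp cyc)
    supp' : ∀ t → S t ≡ false → f t ≡ 0ℚ
    supp' t St with t ≟ₜ σ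
    ... | yes refl = fσ
    ... | no t≢σ = supp t (¬T⇒≡false λ p → notin (insert⁻ S σ t (T⇒≡ p)))
      where
      notin : S t ≡ true ⊎ t ≡ σ → ⊥
      notin (inj₁ q) = true≢false q St
      notin (inj₂ q) = t≢σ q

  -- Pair the cycle with the coboundary of the indicator function of the vertex suc v.
  star-determined : ∀ {m} (f : Tri (suc m) → ℚ) → (∀ e → comb f (liftE e) ≡ 0ℚ) → ∀ e → comb f e ≡ 0ℚ
  star-determined f p (edge (suc u) (suc v) (s≤s q)) = p (edge u v q)
  star-determined {m} f p e@(edge zero (suc v) (s≤s z≤n)) = begin
    comb f e         ≡⟨ *-identityˡ (comb f e) ⟨
    1ℚ * comb f e    ≡⟨ cong (λ x → (x + - 0ℚ) * comb f e) δ-self ⟨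
    w e * comb f e
      ≡⟨ fold-single +-0-commutativeMonoid {f = λ e → w e * comb f e}
           (edges-unique (suc m)) (edges-complete e) others ⟨
    Σ[ (λ e → w e * comb f e) ] (edges (suc m))       ≡⟨ stokes R w f ⟩
    Σ[ (λ t → f t * coboundary R w t) ] (allTri {suc m})
      ≡⟨ fold-ε +-0-commutativeMonoid (allTri {suc m}) (λ t _ → trans (cong (f t *_) (d² t)) (*-zeroʳ (f t))) ⟩
    0ℚ ∎
    where
    open ≡-Reasoning
    δ : Fin (suc m) → ℚ
    δ x = if eqF x (suc v) then 1ℚ else 0ℚ
    δ-self : δ (suc v) ≡ 1ℚ
    δ-self rewrite eqF-refl (suc v) = refl
    δ-≢ : ∀ {x} → x ≢ suc v → δ x ≡ 0ℚ
    δ-≢ x≢ rewrite eqF-≢ x≢ = refl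
    w : Edge (suc m) → ℚ
    w (edge x y _) = δ y + - δ x
    others : ∀ d → d ≢ e → w d * comb f d ≡ 0ℚ
    others d@(edge (suc x) (suc y) (s≤s q)) d≢e = trans (cong (w d *_) (p (edge x y q))) (*-zeroʳ (w d))
    others d@(edge zero (suc y) _) d≢e =
      trans (cong (λ x → (x + - 0ℚ) * comb f d) (δ-≢ λ y≡v → d≢e (edge-≡ refl y≡v))) (*-zeroˡ (comb f d))
    d² : ∀ t → coboundary R w t ≡ 0ℚ
    d² (tri a b c _ _) =
      solve 3 (λ x y z → (z :+ :- y) :+ (:- (z :+ :- x) :+ (y :+ :- x)) := con 0ℚ) refl (δ a) (δ b) (δ c)
      where open +-*-Solver

  point : ∀ {n} → Tri n → ℚ → Tri n → ℚ
  point s x t = if sameTri t s then x else 0ℚ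

  point-self : ∀ {n} (s : Tri n) x → point s x s ≡ x
  point-self s x rewrite sameTri-refl s = refl

  point-≢ : ∀ {n} (s : Tri n) x t → t ≢ s → point s x t ≡ 0ℚ
  point-≢ s x t t≢s rewrite sameTri-≢ t s t≢s = refl

  ev : ∀ {n} → (Tri n → ℚ) → (Tri n → ℚ) → ℚ
  ev {n} f r = Σ[ (λ t → f t * r t) ] (allTri {n})

  module Elimination {n} (r : Tri n → ℚ) (s : Tri n) (rs≢0 : r s ≢ 0ℚ) where
    private instance _ = ≢-nonZero rs≢0

    -- Clears the form `q` at the pivot `s` by a multiple of `r`. Its transpose is `extend`, which
    -- corrects a vector at `s` alone so that `r` annihilates it; hence solutions of the reduced
    -- forms extend to solutions of the original ones.
    reduce : (Tri n → ℚ) → Tri n → ℚ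
    reduce q t = q t + - (q s * 1/ r s) * r t

    extend : (Tri n → ℚ) → Tri n → ℚ
    extend f t = f t + point s (- (ev f r * 1/ r s)) t

    extend-≢ : ∀ f t → t ≢ s → extend f t ≡ f t
    extend-≢ f t t≢s = trans (cong (f t +_) (point-≢ s _ t t≢s)) (+-identityʳ (f t))

    private
      ev-extend : ∀ f q → ev (extend f) q ≡ ev f q + - (ev f r * 1/ r s) * q s
      ev-extend f q = begin
        ev (extend f) q
          ≡⟨ fold-cong +-0-commutativeMonoid (allTri {n}) (λ t _ → *-distribʳ-+ (q t) (f t) (δ t)) ⟩
        Σ[ (λ t → f t * q t + δ t * q t) ] (allTri {n})
          ≡⟨ fold-∙ +-0-commutativeMonoid (λ t → f t * q t) (λ t → δ t * q t) (allTri {n}) ⟩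
        ev f q + ev δ q
          ≡⟨ cong (ev f q +_) (trans
               (fold-single +-0-commutativeMonoid {f = λ t → δ t * q t} allTri-unique (allTri-complete s)
                 λ t t≢s → trans (cong (_* q t) (point-≢ s _ t t≢s)) (*-zeroˡ (q t)))
               (cong (_* q s) (point-self s _))) ⟩
        ev f q + - (ev f r * 1/ r s) * q s ∎
        where
        open ≡-Reasoning
        δ : Tri n → ℚ
        δ = point s (- (ev f r * 1/ r s))

    ev-extend-pivot : ∀ f → ev (extend f) r ≡ 0ℚ
    ev-extend-pivot f = begin
      ev (extend f) r                    ≡⟨ ev-extend f r ⟩
      ev f r + - (ev f r * 1/ r s) * r s
        ≡⟨ solve 3 (λ x k y → x :+ :- (x :* k) :* y := x :* (con 1ℚ :+ :- (k :* y))) refl (ev f r) (1/ r s) (r s) ⟩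
      ev f r * (1ℚ + - (1/ r s * r s))   ≡⟨ cong (λ x → ev f r * (1ℚ + - x)) (*-inverseˡ (r s)) ⟩
      ev f r * 0ℚ                        ≡⟨ *-zeroʳ (ev f r) ⟩
      0ℚ ∎
      where
      open ≡-Reasoning
      open +-*-Solver

    ev-extend-reduce : ∀ f q → ev (extend f) q ≡ ev f (reduce q)
    ev-extend-reduce f q = begin
      ev (extend f) q                       ≡⟨ ev-extend f q ⟩
      ev f q + - (ev f r * 1/ r s) * q s
        ≡⟨ solve 4 (λ x y k z → x :+ :- (y :* k) :* z := x :+ :- (z :* k) :* y)
             refl (ev f q) (ev f r) (1/ r s) (q s) ⟩
      ev f q + - (q s * 1/ r s) * ev f r
        ≡⟨ cong (ev f q +_) (*-distribˡ-fold {n} R (- (q s * 1/ r s)) (λ t → f t * r t) (allTri {n})) ⟩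
      ev f q + Σ[ (λ t → - (q s * 1/ r s) * (f t * r t)) ] (allTri {n})
        ≡⟨ fold-∙ +-0-commutativeMonoid (λ t → f t * q t) (λ t → - (q s * 1/ r s) * (f t * r t)) (allTri {n}) ⟨
      Σ[ (λ t → f t * q t + - (q s * 1/ r s) * (f t * r t)) ] (allTri {n})
        ≡⟨ fold-cong +-0-commutativeMonoid (allTri {n}) (λ t _ →
             solve 4 (λ x y z w → x :* (y :+ z :* w) := x :* y :+ z :* (x :* w))
               refl (f t) (q t) (- (q s * 1/ r s)) (r t)) ⟨
      ev f (reduce q) ∎
      where
      open ≡-Reasoning
      open +-*-Solver

  Solution : ∀ {n} → List (Tri n → ℚ) → FaceSet {n} → (Tri n → ℚ) → Set
  Solution rs T f = (∀ t → T t ≡ false → f t ≡ 0ℚ) × (∃ λ t → f t ≢ 0ℚ) × (∀ {r} → r ∈ rs → ev f r ≡ 0ℚ)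

  -- Gaussian elimination.
  underdetermined : ∀ {n} (k : ℕ) (rs : List (Tri n → ℚ)) (T : FaceSet {n}) →
                    length rs ≡ k → k ℕ.< card T → ∃ (Solution rs T)
  underdetermined zero [] T refl 0<card with search T
  ... | inj₂ empty = ⊥-elim (ℕ.<-irrefl (sym (card-empty empty)) 0<card)
  ... | inj₁ (s , Ts) = point s 1ℚ , supp , (s , λ p → 1≢0 (trans (sym (point-self s 1ℚ)) p)) , λ ()
    where
    supp : ∀ t → T t ≡ false → point s 1ℚ t ≡ 0ℚ
    supp t Tt = point-≢ s 1ℚ t λ where refl → true≢false Ts Tt
  underdetermined {n} (suc k) (r ∷ rs) T len le with search (λ t → T t ∧ not (does (r t ≟ 0ℚ)))
  ... | inj₂ none with f , supp , nz , sol ← underdetermined k rs T (ℕ.suc-injective len) (ℕ.<-trans (ℕ.n<1+n _) le) =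
    f , supp , nz , λ where
      (here refl) → fold-ε +-0-commutativeMonoid (allTri {n}) (λ t _ → vanish t)
      (there r∈) → sol r∈
    where
    vanish : ∀ t → f t * r t ≡ 0ℚ
    vanish t with T t in Tt | r t ≟ 0ℚ | none t
    ... | false | _ | _ = trans (cong (_* r t) (supp t Tt)) (*-zeroˡ (r t))
    ... | true | yes rt | _ = trans (cong (f t *_) rt) (*-zeroʳ (f t))
    ... | true | no _ | ()
  ... | inj₁ (s , p) with r s ≟ 0ℚ | ∧-true⁻ {T s} p
  ...   | yes _ | _ , ()
  ...   | no rs≢0 | Ts , _ = extended (underdetermined k (map reduce rs) (remove s T)
      (trans (length-map reduce rs) (ℕ.suc-injective len))
      (ℕ.s≤s⁻¹ (subst (suc k ℕ.<_) (sym (card-remove T s Ts)) le)))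
    where
    open Elimination r s rs≢0
    extended : ∃ (Solution (map reduce rs) (remove s T)) → ∃ (Solution (r ∷ rs) T)
    extended (f , supp , (t , ft≢0) , sol) = extend f , supp' , (t , nz) , λ where
        (here refl) → ev-extend-pivot f
        (there q∈) → trans (ev-extend-reduce f _) (sol (∈-map⁺ reduce q∈))
      where
      supp' : ∀ t → T t ≡ false → extend f t ≡ 0ℚ
      supp' t Tt = trans (extend-≢ f t λ where refl → true≢false Ts Tt)
                         (supp t (cong (_∧ not (sameTri t s)) Tt))
      nz : extend f t ≢ 0ℚ
      nz gt = ft≢0 (trans (sym (extend-≢ f t λ where refl → ft≢0 (supp s (remove-self T s)))) gt)

  -- By `star-determined` the rows of the edges avoiding vertex 0 already imply all the others. With
  -- more than `m C 2` faces these `m C 2` equations have a nonzero solution supported on `T`,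
  -- contradicting independence.
  rank-bound : ∀ {m} {T : FaceSet {suc m}} → Independent T → card T ℕ.≤ m C 2
  rank-bound {m} {T} indep with ℕ.≤-<-connex (card T) (m C 2)
  ... | inj₁ le = le
  ... | inj₂ gt = ⊥-elim (contra (underdetermined (m C 2) (map row (edges m)) T
           (trans (length-map row (edges m)) (length-edges m)) gt))
    where
    row : Edge m → Tri (suc m) → ℚ
    row e t = bd t (liftE e)
    contra : ¬ ∃ (Solution (map row (edges m)) T)
    contra (f , supp , (t , ft≢0) , sol) =
      ft≢0 (indep f supp (star-determined f λ e → sol (∈-map⁺ row (edges-complete e))) t)

open import Data.Integer as ℤ using (ℤ; +_; 0ℤ; 1ℤ; -1ℤ; ∣_∣; _+_; _*_; -_)
open import Data.Integer.DivMod using (_%ℕ_; _/ℕ_; n%ℕd<d; a≡a%ℕn+[a/ℕn]*n)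
open import Data.Integer.Divisibility.Signed
  using (_∣_; divides; _∣?_; ∣-refl; ∣⇒∣ᵤ; ∣ᵤ⇒∣; ∣m∣n⇒∣m+n; ∣n⇒∣m*n)
open import Data.Integer.Properties
  using (neg-distribʳ-*; neg-involutive; *-cancelˡ-≡; abs-*; +-identityˡ; +-identityʳ; +-inverseʳ;
         ∣m⊝n∣≤m⊔n; m-n≡m⊖n; ∣i∣≡0⇒i≡0; +-injective; pos-+; pos-*)
open import Data.Integer.Solver using (module +-*-Solver)
open +-*-Solver using (solve; _:+_; _:*_; :-_; con; _:=_)

-- Signed powers of two.

data Unit : ℤ → Set where
  plus  : Unit 1ℤ
  minus : Unit -1ℤ

-- The exponent is the index and the sign sits in the base case: removing a factor of two is pattern
-- matching, and parity is visible from the constructor.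
data Pow2 : ℕ → ℤ → Set where
  unit : ∀ {x} → Unit x → Pow2 0 x
  dbl  : ∀ {k x} → Pow2 k x → Pow2 (suc k) (+ 2 * x)

pow2-neg : ∀ {k x} → Pow2 k x → Pow2 k (- x)
pow2-neg (unit plus) = unit minus
pow2-neg (unit minus) = unit plus
pow2-neg (dbl {x = x} p) = subst (Pow2 _) (sym (neg-distribʳ-* (+ 2) x)) (dbl (pow2-neg p))

pow2-± : ∀ {k x y} → Pow2 k x → Pow2 k y → x ≡ y ⊎ x ≡ - y
pow2-± (unit plus) (unit plus) = inj₁ refl
pow2-± (unit plus) (unit minus) = inj₂ refl
pow2-± (unit minus) (unit plus) = inj₂ refl
pow2-± (unit minus) (unit minus) = inj₁ refl
pow2-± (dbl p) (dbl {x = y} q) with pow2-± p q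
... | inj₁ refl = inj₁ refl
... | inj₂ refl = inj₂ (sym (neg-distribʳ-* (+ 2) y))

pow2-≢0 : ∀ {k x} → Pow2 k x → x ≢ 0ℤ
pow2-≢0 (unit plus) ()
pow2-≢0 (unit minus) ()
pow2-≢0 (dbl {x = x} p) eq = pow2-≢0 p (*-cancelˡ-≡ (+ 2) x 0ℤ eq)

pow2-exists : ∀ k → ∃ (Pow2 k)
pow2-exists zero = 1ℤ , unit plus
pow2-exists (suc k) with x , p ← pow2-exists k = + 2 * x , dbl p

unit≢double : ∀ {x} y → Unit x → x ≢ + 2 * y
unit≢double y u eq = odd {∣ y ∣} (trans (sym (abs-* (+ 2) y)) (sym (trans (abs-unit u) (cong ∣_∣ eq))))
  where
  abs-unit : ∀ {x} → Unit x → 1 ≡ ∣ x ∣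
  abs-unit plus = refl
  abs-unit minus = refl
  odd : ∀ {m} → 2 ℕ.* m ≢ 1
  odd {suc m} p with () ← trans (sym (ℕ.+-suc m (m ℕ.+ 0))) (ℕ.suc-injective p)

-- The weights met on walking around a progression: two equal steps, then the way back.
data Balanced : ℤ → ℤ → ℤ → Set where
  balance : ∀ x → Balanced x x (- (+ 2 * x))

balanced-swap : ∀ {x y z} → Balanced x y z → Balanced y x z
balanced-swap (balance x) = balance x

balanced-sum : ∀ {x y z} → Balanced x y z → x + y + z ≡ 0ℤ
balanced-sum (balance x) = solve 1 (λ x → x :+ x :+ :- (con (+ 2) :* x) := con 0ℤ) refl x

balanced-double : ∀ {x y z} → Balanced x y z → Balanced (+ 2 * x) (+ 2 * y) (+ 2 * z)
balanced-double (balance x) =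
  subst (Balanced _ _) (neg-distribʳ-* (+ 2) (+ 2 * x)) (balance (+ 2 * x))

-- Strip common factors of two, then compare parities.
pow2-sum : ∀ {i j k x y z} → Pow2 i x → Pow2 j y → Pow2 k z → x + y + z ≡ 0ℤ →
           Balanced x y z ⊎ Balanced y z x ⊎ Balanced x z y
pow2-sum (unit p) (unit q) (unit r) eq = ⊥-elim (three p q r eq)
  where
  three : ∀ {x y z} → Unit x → Unit y → Unit z → x + y + z ≢ 0ℤ
  three plus plus plus ()
  three plus plus minus ()
  three plus minus plus ()
  three plus minus minus ()
  three minus plus plus ()
  three minus plus minus ()
  three minus minus plus ()
  three minus minus minus ()
pow2-sum {x = x} {y} (unit p) (unit q) (dbl {x = z} r) eq = inj₁ (two p q r eq)
  where
  two : ∀ {k x y z} → Unit x → Unit y → Pow2 k z → x + y + + 2 * z ≡ 0ℤ → Balanced x y (+ 2 * z)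
  two {x = x} {y} {z} u v r eq with pow2-± (unit u) (unit v)
  ... | inj₁ refl = subst (Balanced x x)
    (trans (solve 2 (λ x z → :- (con (+ 2) :* x) := con (+ 2) :* z :+ :- (x :+ x :+ con (+ 2) :* z)) refl x z)
      (trans (cong (λ s → + 2 * z + - s) eq) (+-identityʳ (+ 2 * z)))) (balance x)
  ... | inj₂ refl = ⊥-elim (pow2-≢0 (dbl r) (trans
    (solve 2 (λ y z → con (+ 2) :* z := :- y :+ y :+ con (+ 2) :* z) refl y z) eq))
pow2-sum {x = x} {z = z} (unit p) (dbl {x = y} q) (unit r) eq
  with pow2-sum (unit p) (unit r) (dbl q)
         (trans (solve 3 (λ x y z → x :+ z :+ y := x :+ y :+ z) refl x (+ 2 * y) z) eq)
... | inj₁ b = inj₂ (inj₂ b)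
... | inj₂ (inj₁ b) = inj₂ (inj₁ (balanced-swap b))
... | inj₂ (inj₂ b) = inj₁ b
pow2-sum {y = y} {z = z} (dbl {x = x} p) (unit q) (unit r) eq
  with pow2-sum (unit q) (unit r) (dbl p)
         (trans (solve 3 (λ x y z → y :+ z :+ x := x :+ y :+ z) refl (+ 2 * x) y z) eq)
... | inj₁ b = inj₂ (inj₁ b)
... | inj₂ (inj₁ b) = inj₂ (inj₂ (balanced-swap b))
... | inj₂ (inj₂ b) = inj₁ (balanced-swap b)
pow2-sum {x = x} (unit p) (dbl {x = y} q) (dbl {x = z} r) eq = ⊥-elim (unit≢double (- (y + z)) p
  (trans (solve 3 (λ x y z → x := (x :+ con (+ 2) :* y :+ con (+ 2) :* z) :+ con (+ 2) :* (:- (y :+ z))) refl x y z)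
    (trans (cong (_+ + 2 * - (y + z)) eq) (+-identityˡ _))))
pow2-sum {y = y} (dbl {x = x} p) (unit q) (dbl {x = z} r) eq = ⊥-elim (unit≢double (- (x + z)) q
  (trans (solve 3 (λ x y z → y := (con (+ 2) :* x :+ y :+ con (+ 2) :* z) :+ con (+ 2) :* (:- (x :+ z))) refl x y z)
    (trans (cong (_+ + 2 * - (x + z)) eq) (+-identityˡ _))))
pow2-sum {z = z} (dbl {x = x} p) (dbl {x = y} q) (unit r) eq = ⊥-elim (unit≢double (- (x + y)) r
  (trans (solve 3 (λ x y z → z := (con (+ 2) :* x :+ con (+ 2) :* y :+ z) :+ con (+ 2) :* (:- (x :+ y))) refl x y z)
    (trans (cong (_+ + 2 * - (x + y)) eq) (+-identityˡ _))))
pow2-sum (dbl {x = x} p) (dbl {x = y} q) (dbl {x = z} r) eq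
  with pow2-sum p q r (*-cancelˡ-≡ (+ 2) (x + y + z) 0ℤ (trans
         (solve 3 (λ x y z → con (+ 2) :* (x :+ y :+ z) := con (+ 2) :* x :+ con (+ 2) :* y :+ con (+ 2) :* z)
           refl x y z) eq))
... | inj₁ b = inj₁ (balanced-double b)
... | inj₂ (inj₁ b) = inj₂ (inj₁ (balanced-double b))
... | inj₂ (inj₂ b) = inj₂ (inj₂ (balanced-double b))

-- Arithmetic modulo n and the weight of a difference.

module Modular (n : ℕ) .{{_ : NonZero n}} (n-prime : Prime n) (5≤n : 5 ℕ.≤ n) where

  infix 4 _≋_ _≋?_

  -- Wrapped in a record so that both sides can be inferred from a proof of congruence, which the
  -- difference alone would not determine.
  record _≋_ (x y : ℤ) : Set where
    constructor mod
    field difference : + n ∣ x + - y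
  open _≋_

  _≋?_ : ∀ x y → Dec (x ≋ y)
  x ≋? y = map′ mod difference (+ n ∣? x + - y)

  -- Congruences are proved by certificates: the new difference is a linear combination of known
  -- differences, and the ring solver checks the identity. `k`, and `l` in `≋-by₂`, are the
  -- coefficients.
  ≋-by : ∀ {a b x y} k → a ≋ b → x + - y ≡ k * (a + - b) → x ≋ y
  ≋-by k (mod p) eq = mod (subst (+ n ∣_) (sym eq) (∣n⇒∣m*n k p))

  ≋-by₂ : ∀ {a b c d x y} k l → a ≋ b → c ≋ d → x + - y ≡ k * (a + - b) + l * (c + - d) → x ≋ y
  ≋-by₂ k l (mod p) (mod q) eq = mod (subst (+ n ∣_) (sym eq) (∣m∣n⇒∣m+n (∣n⇒∣m*n k p) (∣n⇒∣m*n l q)))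

  ≋-refl : ∀ {x} → x ≋ x
  ≋-refl {x} = mod (divides 0ℤ (+-inverseʳ x))

  ≋-reflexive : ∀ {x y} → x ≡ y → x ≋ y
  ≋-reflexive refl = ≋-refl

  ≋-sym : ∀ {x y} → x ≋ y → y ≋ x
  ≋-sym {x} {y} p = ≋-by -1ℤ p (solve 2 (λ x y → y :+ :- x := con -1ℤ :* (x :+ :- y)) refl x y)

  ≋-trans : ∀ {x y z} → x ≋ y → y ≋ z → x ≋ z
  ≋-trans {x} {y} {z} p q = ≋-by₂ 1ℤ 1ℤ p q
    (solve 3 (λ x y z → x :+ :- z := con 1ℤ :* (x :+ :- y) :+ con 1ℤ :* (y :+ :- z)) refl x y z)

  ≋-neg : ∀ {x y} → x ≋ y → - x ≋ - y
  ≋-neg {x} {y} p = ≋-by -1ℤ p (solve 2 (λ x y → :- x :+ :- (:- y) := con -1ℤ :* (x :+ :- y)) refl x y)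

  ≋-*ˡ : ∀ k {x y} → x ≋ y → k * x ≋ k * y
  ≋-*ˡ k {x} {y} p = ≋-by k p (solve 3 (λ k x y → k :* x :+ :- (k :* y) := k :* (x :+ :- y)) refl k x y)

  euclid : ∀ x y → + n ∣ x * y → (+ n ∣ x) ⊎ (+ n ∣ y)
  euclid x y p with euclidsLemma ∣ x ∣ ∣ y ∣ n-prime (subst (n ℕ.∣_) (abs-* x y) (∣⇒∣ᵤ p))
  ... | inj₁ q = inj₁ (∣ᵤ⇒∣ q)
  ... | inj₂ q = inj₂ (∣ᵤ⇒∣ q)

  small-∣⇒≡0 : ∀ {x} → ∣ x ∣ ℕ.< n → + n ∣ x → x ≡ 0ℤ
  small-∣⇒≡0 {x} lt p with ∣ x ∣ in eq | ∣⇒∣ᵤ p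
  ... | zero | _ = ∣i∣≡0⇒i≡0 eq
  ... | suc m | q = ⊥-elim (ℕ.>⇒∤ lt q)

  private
    1<5 : 1 ℕ.< 5
    1<5 = s≤s (s≤s z≤n)
    2<5 : 2 ℕ.< 5
    2<5 = s≤s (s≤s (s≤s z≤n))
    3<5 : 3 ℕ.< 5
    3<5 = s≤s (s≤s (s≤s (s≤s z≤n)))

  cancel-2 : ∀ {x y} → + 2 * x ≋ + 2 * y → x ≋ y
  cancel-2 {x} {y} (mod p) with euclid (+ 2) (x + - y) (subst (+ n ∣_)
    (solve 2 (λ x y → con (+ 2) :* x :+ :- (con (+ 2) :* y) := con (+ 2) :* (x :+ :- y)) refl x y) p)
  ... | inj₁ q with () ← small-∣⇒≡0 (ℕ.<-≤-trans 2<5 5≤n) q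
  ... | inj₂ q = mod q

  cancel-3 : ∀ {x y} → + 3 * x ≋ + 3 * y → x ≋ y
  cancel-3 {x} {y} (mod p) with euclid (+ 3) (x + - y) (subst (+ n ∣_)
    (solve 2 (λ x y → con (+ 3) :* x :+ :- (con (+ 3) :* y) := con (+ 3) :* (x :+ :- y)) refl x y) p)
  ... | inj₁ q with () ← small-∣⇒≡0 (ℕ.<-≤-trans 3<5 5≤n) q
  ... | inj₂ q = mod q

  1≋̸0 : ¬ 1ℤ ≋ 0ℤ
  1≋̸0 (mod p) with () ← small-∣⇒≡0 {1ℤ} (ℕ.<-≤-trans 1<5 5≤n) p

  pow2-≋̸0 : ∀ {k x} → Pow2 k x → ¬ x ≋ 0ℤ
  pow2-≋̸0 (unit plus) p = 1≋̸0 p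
  pow2-≋̸0 (unit minus) p = 1≋̸0 (≋-neg p)
  pow2-≋̸0 (dbl p) q = pow2-≋̸0 p (cancel-2 q)

  record IsWeight (d : ℤ) (k : ℕ) (w : ℤ) : Set where
    constructor isWeight
    field
      pow   : Pow2 k w
      twice : + 2 * w ≋ d
      least : ∀ {j v} → Pow2 j v → + 2 * v ≋ d → k ℕ.≤ j

  -- Minimality on both sides makes the exponents equal, so the weights agree up to sign. Opposite
  -- signs would give 4 w ≡ 0, impossible for a power of two modulo n.
  isWeight-unique : ∀ {d e k l v w} → d ≋ e → IsWeight d k v → IsWeight e l w → k ≡ l × v ≡ w
  isWeight-unique {d} {e} {k} {l} {v} {w} d≋e (isWeight p 2v≋d least₁) (isWeight q 2w≋e least₂)
    with refl ← ℕ.≤-antisym (least₁ q (≋-trans 2w≋e (≋-sym d≋e))) (least₂ p (≋-trans 2v≋d d≋e))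
    with pow2-± p q
  ... | inj₁ v≡w = refl , v≡w
  ... | inj₂ refl = ⊥-elim (pow2-≋̸0 (dbl (dbl q)) (≋-by 1ℤ (≋-trans 2w≋e (≋-sym (≋-trans 2v≋d d≋e)))
          (solve 1 (λ w → con (+ 2) :* (con (+ 2) :* w) :+ :- con 0ℤ
             := con 1ℤ :* (con (+ 2) :* w :+ :- (con (+ 2) :* (:- w)))) refl w)))

  isWeight-neg : ∀ {d k w} → IsWeight d k w → IsWeight (- d) k (- w)
  isWeight-neg {d} {k} {w} (isWeight p 2w≋d least) = isWeight (pow2-neg p)
    (subst (_≋ - d) (neg-distribʳ-* (+ 2) w) (≋-neg 2w≋d))
    λ {_} {v} q 2v≋ → least (pow2-neg q) (subst₂ _≋_ (neg-distribʳ-* (+ 2) v) (neg-involutive d) (≋-neg 2v≋))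

  -- A solution for 2 d of positive exponent halves to one for d, so minimality is inherited. One of
  -- exponent 0 would say 2 d ≡ ±2, that is d ≡ ±1.
  isWeight-double : ∀ {d k w} → ¬ d ≋ 1ℤ → ¬ d ≋ -1ℤ → IsWeight d k w → IsWeight (+ 2 * d) (suc k) (+ 2 * w)
  isWeight-double d≋̸1 d≋̸-1 (isWeight p 2w≋d least) = isWeight (dbl p) (≋-*ˡ (+ 2) 2w≋d) λ where
    (unit plus) q → ⊥-elim (d≋̸1 (cancel-2 (≋-sym q)))
    (unit minus) q → ⊥-elim (d≋̸-1 (cancel-2 (≋-sym q)))
    (dbl r) q → s≤s (least r (cancel-2 q))

  -- The exception to `isWeight-double`: doubling the difference 1 falls back to exponent 0.
  isWeight-2 : IsWeight (+ 2) 0 1ℤ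
  isWeight-2 = isWeight (unit plus) ≋-refl λ _ _ → z≤n

  least-exponent : ∀ d {K v} → Pow2 K v → + 2 * v ≋ d → ∃ λ k → ∃ λ w → IsWeight d k w
  least-exponent d {K} p 2v≋d =
    go K 0 (λ _ _ → z≤n) (_ , subst (λ j → Pow2 j _) (sym (ℕ.+-identityʳ K)) p , 2v≋d)
    where
    Hit : ℕ → Set
    Hit k = ∃ λ v → Pow2 k v × + 2 * v ≋ d
    hit? : ∀ k → Dec (Hit k)
    hit? k with x , p ← pow2-exists k with + 2 * x ≋? d | + 2 * - x ≋? d
    ... | yes q | _ = yes (x , p , q)
    ... | no _ | yes q = yes (- x , pow2-neg p , q)
    ... | no ¬q | no ¬r = no λ (v , p' , s) → neither (pow2-± p' p) s
      where
      neither : ∀ {v} → v ≡ x ⊎ v ≡ - x → ¬ + 2 * v ≋ d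
      neither (inj₁ refl) = ¬q
      neither (inj₂ refl) = ¬r
    -- All exponents below `i` are already excluded; the known solution at `m + i` bounds the
    -- search.
    go : ∀ m i → (∀ {j v} → Pow2 j v → + 2 * v ≋ d → i ℕ.≤ j) → Hit (m ℕ.+ i) →
         ∃ λ k → ∃ λ w → IsWeight d k w
    go zero i low (v , p , q) = i , v , isWeight p q low
    go (suc m) i low hit with hit? i
    ... | yes (v , p , q) = i , v , isWeight p q low
    ... | no miss = go m (suc i)
      (λ p q → ℕ.≤∧≢⇒< (low p q) λ where refl → miss (_ , p , q))
      (subst Hit (sym (ℕ.+-suc m i)) hit)

  %-≋ : ∀ x → + (x % n) ≋ + x
  %-≋ x = ≋-sym (mod (divides (+ (x / n)) (begin
    + x + - + (x % n)                                   ≡⟨ cong (λ y → + y + - + (x % n)) (m≡m%n+[m/n]*n x n) ⟩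
    + (x % n ℕ.+ x / n ℕ.* n) + - + (x % n)             ≡⟨ cong (_+ - + (x % n)) (pos-+ (x % n) (x / n ℕ.* n)) ⟩
    + (x % n) + + (x / n ℕ.* n) + - + (x % n)
      ≡⟨ solve 2 (λ r s → r :+ s :+ :- r := s) refl (+ (x % n)) (+ (x / n ℕ.* n)) ⟩
    + (x / n ℕ.* n)                                     ≡⟨ pos-* (x / n) n ⟩
    + (x / n) * + n                                     ∎)))
    where open ≡-Reasoning

  %ℕ-≋ : ∀ x → + (x %ℕ n) ≋ x
  %ℕ-≋ x = ≋-sym (mod (divides (x /ℕ n) (begin
    x + - + (x %ℕ n)                                ≡⟨ cong (_+ - + (x %ℕ n)) (a≡a%ℕn+[a/ℕn]*n x n) ⟩
    + (x %ℕ n) + (x /ℕ n) * + n + - + (x %ℕ n)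
      ≡⟨ solve 2 (λ r s → r :+ s :+ :- r := s) refl (+ (x %ℕ n)) ((x /ℕ n) * + n) ⟩
    (x /ℕ n) * + n                                  ∎)))
    where open ≡-Reasoning

  n≋0 : + n ≋ 0ℤ
  n≋0 = mod (divides 1ℤ (solve 1 (λ x → x :+ :- con 0ℤ := con 1ℤ :* x) refl (+ n)))

  n∸1≋-1 : + (n ℕ.∸ 1) ≋ -1ℤ
  n∸1≋-1 = mod (subst (+ n ∣_) (cong +_ (sym (ℕ.m∸n+n≡m (ℕ.≤-trans (s≤s z≤n) 5≤n)))) ∣-refl)

  gen⇒pow2 : ∀ {x} → Gen n x → ∃ λ k → ∃ λ v → Pow2 k v × + x ≋ v
  gen⇒pow2 gen-one = 0 , 1ℤ , unit plus , ≋-refl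
  gen⇒pow2 (gen-neg {x} g) with k , v , p , x≋v ← gen⇒pow2 g =
    k , - v , pow2-neg p , ≋-trans (%-≋ (x ℕ.* (n ℕ.∸ 1))) (≋-trans
      (≋-trans (≋-reflexive (pos-* x (n ℕ.∸ 1))) (≋-*ˡ (+ x) n∸1≋-1))
      (≋-by -1ℤ x≋v (solve 2 (λ x v → x :* con -1ℤ :+ :- (:- v) := con -1ℤ :* (x :+ :- v)) refl (+ x) v)))
  gen⇒pow2 (gen-two {x} g) with k , v , p , x≋v ← gen⇒pow2 g =
    suc k , + 2 * v , dbl p , ≋-trans (%-≋ (x ℕ.* 2)) (≋-trans (≋-reflexive (pos-* x 2))
      (≋-by (+ 2) x≋v (solve 2 (λ x v →
        x :* con (+ 2) :+ :- (con (+ 2) :* v) := con (+ 2) :* (x :+ :- v)) refl (+ x) v)))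

  -- The witness is (n + 1) / 2, an integer because a prime n ≥ 5 is odd.
  half : ∃ λ h → + 2 * h ≋ 1ℤ
  half with n % 2 in eq | m%n<n n 2
  ... | 0 | _ with prime⇒irreducible n-prime (ℕ.m%n≡0⇒n∣m n 2 eq)
  ...   | inj₂ refl = ⊥-elim (ℕ.<⇒≱ 2<5 5≤n)
  half | 1 | _ = + suc (n / 2) , ≋-by 1ℤ n≋0 (begin
    + 2 * + suc (n / 2) + - 1ℤ           ≡⟨ cong (λ x → + 2 * x + - 1ℤ) (pos-+ 1 (n / 2)) ⟩
    + 2 * (1ℤ + + (n / 2)) + - 1ℤ
      ≡⟨ solve 1 (λ x → con (+ 2) :* (con 1ℤ :+ x) :+ :- con 1ℤ
           := con 1ℤ :* ((con 1ℤ :+ x :* con (+ 2)) :+ :- con 0ℤ)) refl (+ (n / 2)) ⟩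
    1ℤ * (1ℤ + + (n / 2) * + 2 + - 0ℤ)   ≡⟨ cong (λ x → 1ℤ * (x + - 0ℤ)) n-odd ⟨
    1ℤ * (+ n + - 0ℤ)                    ∎)
    where
    open ≡-Reasoning
    n-odd : + n ≡ 1ℤ + + (n / 2) * + 2
    n-odd = begin
      + n                              ≡⟨ cong +_ (m≡m%n+[m/n]*n n 2) ⟩
      + (n % 2 ℕ.+ n / 2 ℕ.* 2)        ≡⟨ cong (λ r → + (r ℕ.+ n / 2 ℕ.* 2)) eq ⟩
      + (1 ℕ.+ n / 2 ℕ.* 2)            ≡⟨ pos-+ 1 (n / 2 ℕ.* 2) ⟩
      1ℤ + + (n / 2 ℕ.* 2)             ≡⟨ cong (λ x → 1ℤ + x) (pos-* (n / 2) 2) ⟩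
      1ℤ + + (n / 2) * + 2             ∎
  half | suc (suc _) | s≤s (s≤s ())

  module Weights (gen : GeneratedByMinusOneTwo n) where

    weight-exists : ∀ d → ¬ d ≋ 0ℤ → ∃ λ k → ∃ λ w → IsWeight d k w
    weight-exists d d≋̸0 = build (gen⇒pow2 (gen x (ℕ.n≢0⇒n>0 x≢0) (n%ℕd<d (d * h) n)))
      where
      h = proj₁ half
      -- The generation hypothesis is applied to the residue of d / 2, since a weight has to satisfy
      -- 2 w ≡ d.
      x = (d * h) %ℕ n
      2x≋d : + 2 * + x ≋ d
      2x≋d = ≋-trans (≋-*ˡ (+ 2) (%ℕ-≋ (d * h)))
        (≋-by d (proj₂ half) (solve 2 (λ d h →
          con (+ 2) :* (d :* h) :+ :- d := d :* (con (+ 2) :* h :+ :- con 1ℤ)) refl d h))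
      build : (∃ λ k → ∃ λ v → Pow2 k v × + x ≋ v) → ∃ λ k → ∃ λ w → IsWeight d k w
      build (k , v , p , x≋v) = least-exponent d p (≋-trans (≋-sym (≋-*ˡ (+ 2) x≋v)) 2x≋d)
      x≢0 : x ≢ 0
      x≢0 eq = d≋̸0 (≋-trans (≋-sym 2x≋d) (≋-reflexive (cong (λ y → + 2 * + y) eq)))

    abstract
      exponent : ℤ → ℕ
      exponent d with d ≋? 0ℤ
      ... | yes _ = 0
      ... | no ¬p = proj₁ (weight-exists d ¬p)

      weight : ℤ → ℤ
      weight d with d ≋? 0ℤ
      ... | yes _ = 0ℤ
      ... | no ¬p = proj₁ (proj₂ (weight-exists d ¬p))

      weight-spec : ∀ {d} → ¬ d ≋ 0ℤ → IsWeight d (exponent d) (weight d)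
      weight-spec {d} d≋̸0 with d ≋? 0ℤ
      ... | yes p = ⊥-elim (d≋̸0 p)
      ... | no ¬p = proj₂ (proj₂ (weight-exists d ¬p))

+-rotate : ∀ x y z → x + y + z ≡ y + z + x
+-rotate = solve 3 (λ x y z → x :+ y :+ z := y :+ z :+ x) refl

-- Progressions and the weights around a triangle.

module Progressions (n : ℕ) .{{_ : NonZero n}} (n-prime : Prime n) (5≤n : 5 ℕ.≤ n)
                    (gen : GeneratedByMinusOneTwo n) where
  open Modular n n-prime 5≤n
  open Weights gen

  ⟦_⟧ : Fin n → ℤ
  ⟦ x ⟧ = + toℕ x

  ⟦⟧-injective : ∀ {x y} → ⟦ x ⟧ ≋ ⟦ y ⟧ → x ≡ y
  ⟦⟧-injective {x} {y} (mod p) = Fin.toℕ-injective (+-injective (begin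
    ⟦ x ⟧                      ≡⟨ solve 2 (λ x y → x := (x :+ :- y) :+ y) refl ⟦ x ⟧ ⟦ y ⟧ ⟩
    ⟦ x ⟧ + - ⟦ y ⟧ + ⟦ y ⟧    ≡⟨ cong (_+ ⟦ y ⟧) (small-∣⇒≡0 small p) ⟩
    0ℤ + ⟦ y ⟧                 ≡⟨ +-identityˡ ⟦ y ⟧ ⟩
    ⟦ y ⟧                      ∎))
    where
    open ≡-Reasoning
    small : ∣ ⟦ x ⟧ + - ⟦ y ⟧ ∣ ℕ.< n
    small = ℕ.≤-<-trans
      (subst (λ z → ∣ z ∣ ℕ.≤ toℕ x ℕ.⊔ toℕ y) (sym (m-n≡m⊖n (toℕ x) (toℕ y))) (∣m⊝n∣≤m⊔n (toℕ x) (toℕ y)))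
      (ℕ.⊔-lub (Fin.toℕ<n x) (Fin.toℕ<n y))

  abstract
    residue : ∀ z → ∃ λ x → ⟦ x ⟧ ≋ z
    residue z = Fin.fromℕ< (n%ℕd<d z n) ,
      ≋-trans (≋-reflexive (cong +_ (Fin.toℕ-fromℕ< (n%ℕd<d z n)))) (%ℕ-≋ z)

  diff : Fin n → Fin n → ℤ
  diff x y = ⟦ y ⟧ + - ⟦ x ⟧

  diff≋0⇒≡ : ∀ {x y} → diff x y ≋ 0ℤ → x ≡ y
  diff≋0⇒≡ {x} {y} p = sym (⟦⟧-injective (≋-by 1ℤ p
    (solve 2 (λ x y → y :+ :- x := con 1ℤ :* (y :+ :- x :+ :- con 0ℤ)) refl ⟦ x ⟧ ⟦ y ⟧)))

  diff-neg : ∀ x y → - diff x y ≡ diff y x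
  diff-neg x y = solve 2 (λ x y → :- (y :+ :- x) := x :+ :- y) refl ⟦ x ⟧ ⟦ y ⟧

  abstract
    ω : Fin n → Fin n → ℤ
    ω x y = weight (diff x y)

    ε : Fin n → Fin n → ℕ
    ε x y = exponent (diff x y)

    ω-spec : ∀ {x y} → x ≢ y → IsWeight (diff x y) (ε x y) (ω x y)
    ω-spec x≢y = weight-spec (x≢y ∘ diff≋0⇒≡)

  ω-antisym : ∀ {x y} → x ≢ y → ε y x ≡ ε x y × ω y x ≡ - ω x y
  ω-antisym {x} {y} x≢y = isWeight-unique (≋-reflexive (sym (diff-neg x y)))
    (ω-spec (x≢y ∘ sym)) (isWeight-neg (ω-spec x≢y))

  record Progression (p q r : Fin n) : Set where
    constructor progression
    field
      steps   : diff p q ≋ diff q r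
      step≋̸1  : ¬ diff p q ≋ 1ℤ
      step≋̸-1 : ¬ diff p q ≋ -1ℤ

    double-step : diff p r ≋ + 2 * diff p q
    double-step = ≋-by -1ℤ steps (solve 3 (λ p q r → (r :+ :- p) :+ :- (con (+ 2) :* (q :+ :- p))
      := con -1ℤ :* ((q :+ :- p) :+ :- (r :+ :- q))) refl ⟦ p ⟧ ⟦ q ⟧ ⟦ r ⟧)
  open Progression

  progression-sym : ∀ {p q r} → Progression p q r → Progression r q p
  progression-sym {p} {q} {r} (progression s ≢1 ≢-1) = progression
    (subst₂ _≋_ (diff-neg q r) (diff-neg p q) (≋-neg (≋-sym s)))
    (λ e → ≢-1 (≋-trans s (subst (_≋ -1ℤ) (diff-neg r q) (≋-neg e))))
    (λ e → ≢1 (≋-trans s (subst (_≋ 1ℤ) (diff-neg r q) (≋-neg e))))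

  module _ {p q r : Fin n} (p≢q : p ≢ q) (q≢r : q ≢ r) (p≢r : p ≢ r) where

    module _ (ap : Progression p q r) where

      short-weight : ε q r ≡ ε p q × ω q r ≡ ω p q
      short-weight = isWeight-unique (≋-sym (steps ap)) (ω-spec q≢r) (ω-spec p≢q)

      -- The long difference is twice the step, and the excluded steps ±1 are those at which
      -- `isWeight-double` fails.
      long-weight : ε p r ≡ suc (ε p q) × ω p r ≡ + 2 * ω p q
      long-weight = isWeight-unique (double-step ap) (ω-spec p≢r)
        (isWeight-double (step≋̸1 ap) (step≋̸-1 ap) (ω-spec p≢q))

      progression⇒ω-sum : ω p q + ω q r + ω r p ≡ 0ℤ
      progression⇒ω-sum = balanced-sum (subst₂ (Balanced (ω p q)) (sym (proj₂ short-weight))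
        (sym (trans (proj₂ (ω-antisym p≢r)) (cong -_ (proj₂ long-weight)))) (balance (ω p q)))

    -- If the step were ±1 then the weight of the long difference would be the unit ±1, but it is even.
    balanced⇒progression : Balanced (ω p q) (ω q r) (ω r p) → Progression p q r
    balanced⇒progression b = progression same
      (λ e → unit≢double (- ω p q) minus (trans
        (sym (proj₂ (isWeight-unique (≋-by₂ 1ℤ (- + 2) same e
          (solve 3 (λ p q r → (p :+ :- r) :+ :- con (- + 2) := con 1ℤ :* ((q :+ :- p) :+ :- (r :+ :- q))
            :+ con (- + 2) :* ((q :+ :- p) :+ :- con 1ℤ)) refl ⟦ p ⟧ ⟦ q ⟧ ⟦ r ⟧))
          (ω-spec (p≢r ∘ sym)) (isWeight-neg isWeight-2)))) (even b)))
      (λ e → unit≢double (- ω p q) plus (trans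
        (sym (proj₂ (isWeight-unique (≋-by₂ 1ℤ (- + 2) same e
          (solve 3 (λ p q r → (p :+ :- r) :+ :- con (+ 2) := con 1ℤ :* ((q :+ :- p) :+ :- (r :+ :- q))
            :+ con (- + 2) :* ((q :+ :- p) :+ :- con -1ℤ)) refl ⟦ p ⟧ ⟦ q ⟧ ⟦ r ⟧))
          (ω-spec (p≢r ∘ sym)) isWeight-2))) (even b)))
      where
      equal : ∀ {x y z} → Balanced x y z → x ≡ y
      equal (balance _) = refl
      even : ∀ {x y z} → Balanced x y z → z ≡ + 2 * - x
      even (balance x) = neg-distribʳ-* (+ 2) x
      same : diff p q ≋ diff q r
      same = ≋-trans (≋-sym (IsWeight.twice (ω-spec p≢q)))
        (≋-trans (≋-reflexive (cong (+ 2 *_) (equal b))) (IsWeight.twice (ω-spec q≢r)))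

  -- One case for each middle vertex; the two directions of a progression are identified by
  -- `progression-sym`.
  data InX (a b c : Fin n) : Set where
    mid-b : Progression a b c → InX a b c
    mid-a : Progression b a c → InX a b c
    mid-c : Progression a c b → InX a b c

  module _ {a b c : Fin n} (a≢b : a ≢ b) (b≢c : b ≢ c) (a≢c : a ≢ c) where

    inX⇒ω-sum : InX a b c → ω a b + ω b c + ω c a ≡ 0ℤ
    inX⇒ω-sum (mid-b ap) = progression⇒ω-sum a≢b b≢c a≢c ap
    inX⇒ω-sum (mid-a ap) = trans (sym (+-rotate (ω c a) (ω a b) (ω b c)))
      (progression⇒ω-sum (a≢c ∘ sym) a≢b (b≢c ∘ sym) (progression-sym ap))
    inX⇒ω-sum (mid-c ap) = trans (+-rotate (ω a b) (ω b c) (ω c a))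
      (progression⇒ω-sum b≢c (a≢c ∘ sym) (a≢b ∘ sym) (progression-sym ap))

    -- Of three weights with sum zero two are equal; the vertex shared by the corresponding two
    -- edges is the middle one.
    ω-sum⇒inX : ω a b + ω b c + ω c a ≡ 0ℤ → InX a b c
    ω-sum⇒inX eq =
      [ (λ bal → mid-b (balanced⇒progression a≢b b≢c a≢c bal))
      , [ (λ bal → mid-c (progression-sym (balanced⇒progression b≢c (a≢c ∘ sym) (a≢b ∘ sym) bal)))
        , (λ bal → mid-a (progression-sym
            (balanced⇒progression (a≢c ∘ sym) a≢b (b≢c ∘ sym) (balanced-swap bal)))) ]′ ]′
      (pow2-sum (IsWeight.pow (ω-spec a≢b)) (IsWeight.pow (ω-spec b≢c)) (IsWeight.pow (ω-spec (a≢c ∘ sym))) eq)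

  -- Faces of `Xn` as progressions.

  among : ℕ → ℕ → ℕ → ℕ → Bool
  among v p q r = (v ≡ᵇ p) ∨ (v ≡ᵇ q) ∨ (v ≡ᵇ r)

  among₁ : ∀ v q r → among v v q r ≡ true
  among₁ v q r = cong (_∨ ((v ≡ᵇ q) ∨ (v ≡ᵇ r))) (T⇒≡ (ℕ.≡⇒≡ᵇ v v refl))

  among₂ : ∀ p v r → among v p v r ≡ true
  among₂ p v r rewrite T⇒≡ (ℕ.≡⇒≡ᵇ v v refl) = ∨-zeroʳ (v ≡ᵇ p)

  among₃ : ∀ p q v → among v p q v ≡ true
  among₃ p q v rewrite T⇒≡ (ℕ.≡⇒≡ᵇ v v refl) | ∨-zeroʳ (v ≡ᵇ q) = ∨-zeroʳ (v ≡ᵇ p)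

  among⁻ : ∀ v p q r → among v p q r ≡ true → v ≡ p ⊎ v ≡ q ⊎ v ≡ r
  among⁻ v p q r e with ∨-true⁻ {v ≡ᵇ p} e
  ... | inj₁ e₁ = inj₁ (ℕ.≡ᵇ⇒≡ v p (≡⇒T e₁))
  ... | inj₂ e' with ∨-true⁻ {v ≡ᵇ q} e'
  ...   | inj₁ e₂ = inj₂ (inj₁ (ℕ.≡ᵇ⇒≡ v q (≡⇒T e₂)))
  ...   | inj₂ e₃ = inj₂ (inj₂ (ℕ.≡ᵇ⇒≡ v r (≡⇒T e₃)))

  properStep : ℕ → Bool
  properStep d = not (d ≡ᵇ 0) ∧ not (d ≡ᵇ 1) ∧ not (d ≡ᵇ (n ℕ.∸ 1))

  sameTriple : ℕ → ℕ → ℕ → ℕ → ℕ → ℕ → Bool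
  sameTriple a b c p q r =
    among a p q r ∧ among b p q r ∧ among c p q r ∧ among p a b c ∧ among q a b c ∧ among r a b c

  sameTriple⁻ : ∀ a b c p q r → sameTriple a b c p q r ≡ true →
                among a p q r ≡ true × among b p q r ≡ true × among c p q r ≡ true
  sameTriple⁻ a b c p q r e with a∈ , e₁ ← ∧-true⁻ {among a p q r} e
    with b∈ , e₂ ← ∧-true⁻ {among b p q r} e₁ = a∈ , b∈ , proj₁ (∧-true⁻ {among c p q r} e₂)

  not-≡ᵇ⁺ : ∀ {x y} → x ≢ y → not (x ≡ᵇ y) ≡ true
  not-≡ᵇ⁺ {x} {y} x≢y = cong not (¬T⇒≡false (x≢y ∘ ℕ.≡ᵇ⇒≡ x y))

  not-≡ᵇ⁻ : ∀ x y → not (x ≡ᵇ y) ≡ true → x ≢ y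
  not-≡ᵇ⁻ x .x p refl = true≢false (T⇒≡ (ℕ.≡⇒≡ᵇ x x refl)) (not-true p)
    where
    not-true : ∀ {z} → not z ≡ true → z ≡ false
    not-true {false} _ = refl

  reduced-≋⇒≡ : ∀ {x y} → x ℕ.< n → y ℕ.< n → + x ≋ + y → x ≡ y
  reduced-≋⇒≡ {x} {y} x<n y<n p = begin
    x                         ≡⟨ Fin.toℕ-fromℕ< x<n ⟨
    toℕ (Fin.fromℕ< x<n)      ≡⟨ cong toℕ (⟦⟧-injective (subst₂ (λ u v → + u ≋ + v)
                                   (sym (Fin.toℕ-fromℕ< x<n)) (sym (Fin.toℕ-fromℕ< y<n)) p)) ⟩
    toℕ (Fin.fromℕ< y<n)      ≡⟨ Fin.toℕ-fromℕ< y<n ⟩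
    y                         ∎
    where open ≡-Reasoning

  n∸1<n : n ℕ.∸ 1 ℕ.< n
  n∸1<n = ℕ.≤-reflexive (trans (ℕ.+-comm 1 (n ℕ.∸ 1)) (ℕ.m∸n+n≡m (ℕ.≤-trans (s≤s z≤n) 5≤n)))

  properStep⁻ : ∀ d → properStep (toℕ d) ≡ true → ¬ ⟦ d ⟧ ≋ 0ℤ × ¬ ⟦ d ⟧ ≋ 1ℤ × ¬ ⟦ d ⟧ ≋ -1ℤ
  properStep⁻ d p with d≢0 , q ← ∧-true⁻ {not (toℕ d ≡ᵇ 0)} p
    with d≢1 , d≢-1 ← ∧-true⁻ {not (toℕ d ≡ᵇ 1)} q =
      (λ e → not-≡ᵇ⁻ (toℕ d) 0 d≢0 (reduced-≋⇒≡ (Fin.toℕ<n d) (ℕ.<-≤-trans (s≤s z≤n) 5≤n) e))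
    , (λ e → not-≡ᵇ⁻ (toℕ d) 1 d≢1 (reduced-≋⇒≡ (Fin.toℕ<n d) (ℕ.<-≤-trans (s≤s (s≤s z≤n)) 5≤n) e))
    , (λ e → not-≡ᵇ⁻ (toℕ d) (n ℕ.∸ 1) d≢-1
              (reduced-≋⇒≡ (Fin.toℕ<n d) n∸1<n (≋-trans e (≋-sym n∸1≋-1))))

  properStep⁺ : ∀ d → ¬ ⟦ d ⟧ ≋ 0ℤ → ¬ ⟦ d ⟧ ≋ 1ℤ → ¬ ⟦ d ⟧ ≋ -1ℤ → properStep (toℕ d) ≡ true
  properStep⁺ d ≢0 ≢1 ≢-1 = ∧-true⁺ (not-≡ᵇ⁺ λ e → ≢0 (≋-reflexive (cong +_ e)))
    (∧-true⁺ (not-≡ᵇ⁺ λ e → ≢1 (≋-reflexive (cong +_ e)))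
      (not-≡ᵇ⁺ λ e → ≢-1 (≋-trans (≋-reflexive (cong +_ e)) n∸1≋-1)))

  +%-≋ : ∀ x d → + ((x ℕ.+ d) % n) ≋ + x + + d
  +%-≋ x d = ≋-trans (%-≋ (x ℕ.+ d)) (≋-reflexive (pos-+ x d))

  +2*%-≋ : ∀ x d → + ((x ℕ.+ 2 ℕ.* d) % n) ≋ + x + + 2 * + d
  +2*%-≋ x d = ≋-trans (+%-≋ x (2 ℕ.* d)) (≋-reflexive (cong (λ y → + x + y) (pos-* 2 d)))

  progression-from : ∀ {X δ p q r} → ⟦ p ⟧ ≋ X → ⟦ q ⟧ ≋ X + δ → ⟦ r ⟧ ≋ X + + 2 * δ →
                     ¬ δ ≋ 1ℤ → ¬ δ ≋ -1ℤ → Progression p q r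
  progression-from {X} {δ} {p} {q} {r} p≋ q≋ r≋ δ≋̸1 δ≋̸-1 = progression
    (≋-trans pq≋δ (≋-by₂ 1ℤ -1ℤ q≋ r≋ (solve 4 (λ x d q r → d :+ :- (r :+ :- q)
      := con 1ℤ :* (q :+ :- (x :+ d)) :+ con -1ℤ :* (r :+ :- (x :+ con (+ 2) :* d))) refl X δ ⟦ q ⟧ ⟦ r ⟧)))
    (λ e → δ≋̸1 (≋-trans (≋-sym pq≋δ) e))
    (λ e → δ≋̸-1 (≋-trans (≋-sym pq≋δ) e))
    where
    pq≋δ : diff p q ≋ δ
    pq≋δ = ≋-by₂ 1ℤ -1ℤ q≋ p≋ (solve 4 (λ x d p q → (q :+ :- p) :+ :- d
      := con 1ℤ :* (q :+ :- (x :+ d)) :+ con -1ℤ :* (p :+ :- x)) refl X δ ⟦ p ⟧ ⟦ q ⟧)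

  triple⇒inX : ∀ {a b c} x d → a ≢ b → b ≢ c → a ≢ c → properStep (toℕ d) ≡ true →
    sameTriple (toℕ a) (toℕ b) (toℕ c)
      (toℕ x % n) ((toℕ x ℕ.+ toℕ d) % n) ((toℕ x ℕ.+ 2 ℕ.* toℕ d) % n) ≡ true → InX a b c
  triple⇒inX {a} {b} {c} x d a≢b b≢c a≢c ok same =
    let a∈ , b∈ , c∈ = sameTriple⁻ (toℕ a) (toℕ b) (toℕ c) (toℕ x % n)
                         ((toℕ x ℕ.+ toℕ d) % n) ((toℕ x ℕ.+ 2 ℕ.* toℕ d) % n) same
    in place (position a a∈) (position b b∈) (position c c∈)
    where
    data Position (v : Fin n) : Set where
      first  : ⟦ v ⟧ ≋ ⟦ x ⟧ → Position v
      second : ⟦ v ⟧ ≋ ⟦ x ⟧ + ⟦ d ⟧ → Position v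
      third  : ⟦ v ⟧ ≋ ⟦ x ⟧ + + 2 * ⟦ d ⟧ → Position v
    position : ∀ v → among (toℕ v) (toℕ x % n) ((toℕ x ℕ.+ toℕ d) % n) ((toℕ x ℕ.+ 2 ℕ.* toℕ d) % n) ≡ true →
               Position v
    position v e with among⁻ (toℕ v) _ _ _ e
    ... | inj₁ p = first (≋-trans (≋-reflexive (cong +_ p)) (%-≋ (toℕ x)))
    ... | inj₂ (inj₁ p) = second (≋-trans (≋-reflexive (cong +_ p)) (+%-≋ (toℕ x) (toℕ d)))
    ... | inj₂ (inj₂ p) = third (≋-trans (≋-reflexive (cong +_ p)) (+2*%-≋ (toℕ x) (toℕ d)))
    clash : ∀ {u v z} {A : Set} → u ≢ v → ⟦ u ⟧ ≋ z → ⟦ v ⟧ ≋ z → A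
    clash u≢v p q = ⊥-elim (u≢v (⟦⟧-injective (≋-trans p (≋-sym q))))
    ap : ∀ {u v w} → ⟦ u ⟧ ≋ ⟦ x ⟧ → ⟦ v ⟧ ≋ ⟦ x ⟧ + ⟦ d ⟧ → ⟦ w ⟧ ≋ ⟦ x ⟧ + + 2 * ⟦ d ⟧ → Progression u v w
    ap p q r = progression-from p q r (proj₁ (proj₂ (properStep⁻ d ok))) (proj₂ (proj₂ (properStep⁻ d ok)))
    place : Position a → Position b → Position c → InX a b c
    -- Two vertices in the same position would coincide. The six assignments left are the orderings
    -- of the progression.
    place (first p) (first q) _ = clash a≢b p q
    place (second p) (second q) _ = clash a≢b p q
    place (third p) (third q) _ = clash a≢b p q
    place (first p) _ (first q) = clash a≢c p q
    place (second p) _ (second q) = clash a≢c p q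
    place (third p) _ (third q) = clash a≢c p q
    place _ (first p) (first q) = clash b≢c p q
    place _ (second p) (second q) = clash b≢c p q
    place _ (third p) (third q) = clash b≢c p q
    place (first p) (second q) (third r) = mid-b (ap p q r)
    place (first p) (third q) (second r) = mid-c (ap p r q)
    place (second p) (first q) (third r) = mid-a (ap q p r)
    place (second p) (third q) (first r) = mid-a (progression-sym (ap r p q))
    place (third p) (first q) (second r) = mid-c (progression-sym (ap q r p))
    place (third p) (second q) (first r) = mid-b (progression-sym (ap r q p))

  <⇒≢ : ∀ {x y : Fin n} → x Fin.< y → x ≢ y
  <⇒≢ x<y refl = ℕ.<-irrefl refl x<y

  faceTest : Fin n → Fin n → Fin n → Fin n → Fin n → Bool
  faceTest a b c x d = properStep (toℕ d) ∧ sameTriple (toℕ a) (toℕ b) (toℕ c)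
    (toℕ x % n) ((toℕ x ℕ.+ toℕ d) % n) ((toℕ x ℕ.+ 2 ℕ.* toℕ d) % n)

  -- The tests above repeat the local functions of `Xn`, which cannot be named outside it; that they
  -- match is a matter of computation.
  Xn≡any : ∀ a b c p q → Xn n (tri a b c p q) ≡ any (λ x → any (faceTest a b c x) (allFin n)) (allFin n)
  Xn≡any a b c p q = refl

  any-true⁻ : ∀ (f : Fin n → Bool) → any f (allFin n) ≡ true → ∃ λ x → f x ≡ true
  any-true⁻ f e with x , p ← Any.satisfied (any⁻ f (allFin n) (≡⇒T e)) = x , T⇒≡ p

  any-true⁺ : ∀ (f : Fin n → Bool) x → f x ≡ true → any f (allFin n) ≡ true
  any-true⁺ f x e = T⇒≡ (any⁺ f (lose (∈-allFin x) (≡⇒T e)))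

  Xn⇒inX : ∀ a b c p q → Xn n (tri a b c p q) ≡ true → InX a b c
  Xn⇒inX a b c a<b b<c e =
    let x , e₁ = any-true⁻ (λ x → any (faceTest a b c x) (allFin n)) (trans (sym (Xn≡any a b c a<b b<c)) e)
        d , e₂ = any-true⁻ (faceTest a b c x) e₁
        ok , same = ∧-true⁻ {properStep (toℕ d)} e₂
    in triple⇒inX x d (<⇒≢ a<b) (<⇒≢ b<c) (<⇒≢ (ℕ.<-trans a<b b<c)) ok same

  progression⇒Xn : ∀ {a b c p q r} a<b b<c → p ≢ q → Progression p q r →
    sameTriple (toℕ a) (toℕ b) (toℕ c) (toℕ p) (toℕ q) (toℕ r) ≡ true → Xn n (tri a b c a<b b<c) ≡ true
  progression⇒Xn {a} {b} {c} {p} {q} {r} a<b b<c p≢q ap same =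
    trans (Xn≡any a b c a<b b<c) (any-true⁺ (λ x → any (faceTest a b c x) (allFin n)) p
      (any-true⁺ (faceTest a b c p) d (∧-true⁺ ok same')))
    where
    -- The search in `Xn` succeeds with start `p` and with the step reduced to a residue in `Fin n`.
    d = proj₁ (residue (diff p q))
    d≋ = proj₂ (residue (diff p q))
    ok : properStep (toℕ d) ≡ true
    ok = properStep⁺ d (λ e → p≢q (diff≋0⇒≡ (≋-trans (≋-sym d≋) e)))
      (λ e → step≋̸1 ap (≋-trans (≋-sym d≋) e)) (λ e → step≋̸-1 ap (≋-trans (≋-sym d≋) e))
    first : toℕ p % n ≡ toℕ p
    first = m<n⇒m%n≡m (Fin.toℕ<n p)
    second : (toℕ p ℕ.+ toℕ d) % n ≡ toℕ q
    second = reduced-≋⇒≡ (m%n<n (toℕ p ℕ.+ toℕ d) n) (Fin.toℕ<n q)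
      (≋-trans (+%-≋ (toℕ p) (toℕ d)) (≋-by 1ℤ d≋
        (solve 3 (λ p q d → p :+ d :+ :- q := con 1ℤ :* (d :+ :- (q :+ :- p))) refl ⟦ p ⟧ ⟦ q ⟧ ⟦ d ⟧)))
    third : (toℕ p ℕ.+ 2 ℕ.* toℕ d) % n ≡ toℕ r
    third = reduced-≋⇒≡ (m%n<n (toℕ p ℕ.+ 2 ℕ.* toℕ d) n) (Fin.toℕ<n r)
      (≋-trans (+2*%-≋ (toℕ p) (toℕ d)) (≋-by₂ (+ 2) 1ℤ d≋ (steps ap)
        (solve 4 (λ p q r d → p :+ con (+ 2) :* d :+ :- r
          := con (+ 2) :* (d :+ :- (q :+ :- p)) :+ con 1ℤ :* ((q :+ :- p) :+ :- (r :+ :- q)))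
          refl ⟦ p ⟧ ⟦ q ⟧ ⟦ r ⟧ ⟦ d ⟧)))
    same' : sameTriple (toℕ a) (toℕ b) (toℕ c)
              (toℕ p % n) ((toℕ p ℕ.+ toℕ d) % n) ((toℕ p ℕ.+ 2 ℕ.* toℕ d) % n) ≡ true
    same' = resp (sym first) (sym second) (sym third) same
      where
      resp : ∀ {u u' v v' w w'} → u ≡ u' → v ≡ v' → w ≡ w' →
             sameTriple (toℕ a) (toℕ b) (toℕ c) u v w ≡ true → sameTriple (toℕ a) (toℕ b) (toℕ c) u' v' w' ≡ true
      resp refl refl refl e = e

  sameTriple-abc : ∀ a b c → sameTriple a b c a b c ≡ true
  sameTriple-abc a b c rewrite among₁ a b c | among₂ a b c | among₃ a b c = refl

  sameTriple-bac : ∀ a b c → sameTriple a b c b a c ≡ true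
  sameTriple-bac a b c
    rewrite among₁ a b c | among₂ a b c | among₃ a b c | among₁ b a c | among₂ b a c | among₃ b a c = refl

  sameTriple-acb : ∀ a b c → sameTriple a b c a c b ≡ true
  sameTriple-acb a b c
    rewrite among₁ a b c | among₂ a b c | among₃ a b c | among₁ a c b | among₂ a c b | among₃ a c b = refl

  inX⇒Xn : ∀ a b c p q → InX a b c → Xn n (tri a b c p q) ≡ true
  inX⇒Xn a b c p q (mid-b ap) =
    progression⇒Xn p q (<⇒≢ p) ap (sameTriple-abc (toℕ a) (toℕ b) (toℕ c))
  inX⇒Xn a b c p q (mid-a ap) =
    progression⇒Xn p q (<⇒≢ p ∘ sym) ap (sameTriple-bac (toℕ a) (toℕ b) (toℕ c))
  inX⇒Xn a b c p q (mid-c ap) =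
    progression⇒Xn p q (<⇒≢ (ℕ.<-trans p q)) ap (sameTriple-acb (toℕ a) (toℕ b) (toℕ c))

-- Collapsing the complex along long edges.

-- X stands for Xn n, which is too expensive to unfold during conversion checking.
module Complex (n : ℕ) .{{_ : NonZero n}} (n-prime : Prime n) (5≤n : 5 ℕ.≤ n)
               (gen : GeneratedByMinusOneTwo n) (X : FaceSet {n})
               (X⇒inX : ∀ a b c p q → X (tri a b c p q) ≡ true → Progressions.InX n n-prime 5≤n gen a b c)
               (inX⇒X : ∀ a b c p q → Progressions.InX n n-prime 5≤n gen a b c → X (tri a b c p q) ≡ true) where
  open Modular n n-prime 5≤n
  open Progressions n n-prime 5≤n gen

  -- If the step of a face has exponent k, its edges have exponents k, k and k + 1, so the rank 3 k
  -- + 1 orders faces by the size of the weight of the step. The sum is symmetric and does not ask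
  -- which vertex is the middle one.
  rank : Tri n → ℕ
  rank (tri a b c _ _) = ε a b ℕ.+ ε b c ℕ.+ ε a c

  ε-sym : ∀ {x y} → x ≢ y → ε y x ≡ ε x y
  ε-sym x≢y = proj₁ (ω-antisym x≢y)

  swap-bc : ∀ {a b c} → InX a b c → InX a c b
  swap-bc (mid-b ap) = mid-c ap
  swap-bc (mid-a ap) = mid-a (progression-sym ap)
  swap-bc (mid-c ap) = mid-b ap

  rotate : ∀ {a b c} → InX a b c → InX b c a
  rotate (mid-b ap) = mid-a (progression-sym ap)
  rotate (mid-a ap) = mid-c ap
  rotate (mid-c ap) = mid-b (progression-sym ap)

  X⇒inX-spans : ∀ {u v z t} → Spans u v z t → X t ≡ true → InX u v z
  X⇒inX-spans (spans-ab p q) e = X⇒inX _ _ _ p q e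
  X⇒inX-spans (spans-ac p q) e = swap-bc (X⇒inX _ _ _ p q e)
  X⇒inX-spans (spans-bc p q) e = rotate (X⇒inX _ _ _ p q e)

  inX⇒X-spans : ∀ {u v z t} → Spans u v z t → InX u v z → X t ≡ true
  inX⇒X-spans (spans-ab p q) i = inX⇒X _ _ _ p q i
  inX⇒X-spans (spans-ac p q) i = inX⇒X _ _ _ p q (swap-bc i)
  inX⇒X-spans (spans-bc p q) i = inX⇒X _ _ _ p q (rotate (rotate i))

  spans-distinct : ∀ {u v z t} → Spans u v z t → u ≢ v × v ≢ z × u ≢ z
  spans-distinct (spans-ab p q) = <⇒≢ p , <⇒≢ q , <⇒≢ (ℕ.<-trans p q)
  spans-distinct (spans-ac p q) = <⇒≢ (ℕ.<-trans p q) , <⇒≢ q ∘ sym , <⇒≢ p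
  spans-distinct (spans-bc p q) = <⇒≢ q , <⇒≢ (ℕ.<-trans p q) ∘ sym , <⇒≢ p ∘ sym

  rank-spans : ∀ {u v z t} → Spans u v z t → rank t ≡ ε u v ℕ.+ ε v z ℕ.+ ε u z
  rank-spans (spans-ab _ _) = refl
  rank-spans {u} {v} {z} (spans-ac p q) = trans (sum-reverse (ε u v) (ε z v) (ε u z))
    (cong (λ k → ε u v ℕ.+ k ℕ.+ ε u z) (ε-sym (<⇒≢ q ∘ sym)))
  rank-spans {u} {v} {z} (spans-bc p q) = trans (sum-rotate (ε u v) (ε z v) (ε z u))
    (cong₂ (λ j k → ε u v ℕ.+ j ℕ.+ k) (ε-sym (<⇒≢ (ℕ.<-trans p q) ∘ sym)) (ε-sym (<⇒≢ p ∘ sym)))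

  -- Both short edges have exponent one below that of the long edge, so the rank is 3 e - 2 with e =
  -- `ε u v`; the additive form avoids subtraction.
  rank-long : ∀ {u v z t} → Spans u v z t → Progression u z v → 2 ℕ.+ rank t ≡ 3 ℕ.* ε u v
  rank-long s ap with u≢v , v≢z , u≢z ← spans-distinct s =
    long-sum (rank-spans s) (proj₁ (long-weight u≢z (v≢z ∘ sym) u≢v ap))
      (trans (ε-sym (v≢z ∘ sym)) (proj₁ (short-weight u≢z (v≢z ∘ sym) u≢v ap)))

  rank-short : ∀ {u v z t} → Spans u v z t → Progression u v z ⊎ Progression v u z → rank t ≡ 1 ℕ.+ 3 ℕ.* ε u v
  rank-short s (inj₁ ap) with u≢v , v≢z , u≢z ← spans-distinct s =
    short-sum (rank-spans s) (proj₁ (short-weight u≢v v≢z u≢z ap)) (proj₁ (long-weight u≢v v≢z u≢z ap))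
  rank-short s (inj₂ ap) with u≢v , v≢z , u≢z ← spans-distinct s =
    short-sum′ (rank-spans s)
      (trans (proj₁ (long-weight (u≢v ∘ sym) u≢z v≢z ap)) (cong suc (ε-sym u≢v)))
      (trans (proj₁ (short-weight (u≢v ∘ sym) u≢z v≢z ap)) (ε-sym u≢v))

  midpoint-unique : ∀ {u v y z} → Progression u y v → Progression u z v → y ≡ z
  midpoint-unique {u} {v} {y} {z} ap ap' = ⟦⟧-injective (cancel-2 (≋-by₂ 1ℤ -1ℤ (steps ap) (steps ap')
    (solve 4 (λ u v y z → con (+ 2) :* y :+ :- (con (+ 2) :* z)
      := con 1ℤ :* ((y :+ :- u) :+ :- (v :+ :- y)) :+ con -1ℤ :* ((z :+ :- u) :+ :- (v :+ :- z)))
      refl ⟦ u ⟧ ⟦ v ⟧ ⟦ y ⟧ ⟦ z ⟧)))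
    where open Progression

  -- For one and the same edge of exponent e, the rank is 3 e - 2 where the edge is long and 3 e + 1
  -- where it is short.
  short<long : ∀ {u v y z s t} → Spans u v y s → Progression u v y ⊎ Progression v u y →
               Spans u v z t → Progression u z v → rank t ℕ.< rank s
  short<long {t = t} span-s ap span-t ap' =
    subst (rank t ℕ.<_) (sym (trans (rank-short span-s ap) (cong suc (sym (rank-long span-t ap')))))
      (ℕ.m≤n⇒m≤1+n (ℕ.m≤n⇒m≤1+n (ℕ.n<1+n (rank t))))

  -- A second face in which `u`, `v` is the long edge has the same midpoint, hence is the same face;
  -- one in which it is a short edge has too large a rank.
  midpoint-face-unique : ∀ {u v y z s t} → Spans u v z t → Progression u z v → Spans u v y s → InX u v y →
                         rank s ℕ.≤ rank t → s ≡ t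
  midpoint-face-unique {u} {v} {s = s} span-t ap span-s (mid-c ap') le =
    spans-unique (subst (λ y → Spans u v y s) (midpoint-unique ap' ap) span-s) span-t
  midpoint-face-unique span-t ap span-s (mid-b ap') le = ⊥-elim (ℕ.<⇒≱ (short<long span-s (inj₁ ap') span-t ap) le)
  midpoint-face-unique span-t ap span-s (mid-a ap') le = ⊥-elim (ℕ.<⇒≱ (short<long span-s (inj₂ ap') span-t ap) le)

  LongEdge : Tri n → Set
  LongEdge t = ∃ λ (e : Edge n) → ∃ λ z → Spans (Edge.u e) (Edge.v e) z t × Progression (Edge.u e) z (Edge.v e)

  inX⇒longEdge : ∀ {a b c} p q → InX a b c → LongEdge (tri a b c p q)
  inX⇒longEdge {a} {b} {c} p q (mid-b ap) = edge a c (ℕ.<-trans p q) , b , spans-ac p q , ap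
  inX⇒longEdge {a} {b} {c} p q (mid-a ap) = edge b c q , a , spans-bc p q , ap
  inX⇒longEdge {a} {b} {c} p q (mid-c ap) = edge a b p , c , spans-ab p q , ap

  -- A face of maximal rank is exposed at its long edge.
  X-collapsible : Collapsible X
  X-collapsible = collapsible-by-rank X rank λ t@(tri a b c p q) Xt →
    let e , z , span-t , ap = inX⇒longEdge p q (X⇒inX a b c p q Xt)
    in e , spans⇒edgeIn {u<v = Edge.u<v e} span-t , λ s Xs e∈s le →
       let y , span-s = edgeIn⇒spans {u<v = Edge.u<v e} s e∈s
       in midpoint-face-unique span-t ap span-s (X⇒inX-spans span-s Xs) le

  -- Counting faces by their long edges.

  longest : Tri n → Edge n
  longest (tri a b c p q) with ℕ.<-cmp (ε a b) (ε a c)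
  ... | tri< _ _ _ = edge a c (ℕ.<-trans p q)
  ... | tri≈ _ _ _ = edge b c q
  ... | tri> _ _ _ = edge a b p

  -- The long edge has the larger exponent and the short ones agree, so comparing `ε a b` with
  -- `ε a c` identifies it: less means `a c` is long, equal means `b c`, greater means `a b`.
  longest-spans : ∀ {u v z t u<v} → Spans u v z t → Progression u z v → longest t ≡ edge u v u<v
  longest-spans {u} {v} {z} (spans-ab p q) ap with ℕ.<-cmp (ε u v) (ε u z)
  ... | tri> _ _ _ = edge-≡ refl refl
  ... | tri< _ _ ¬> = ⊥-elim (¬> (ℕ.≤-reflexive (sym (proj₁
          (long-weight (<⇒≢ (ℕ.<-trans p q)) (<⇒≢ q ∘ sym) (<⇒≢ p) ap)))))
  ... | tri≈ _ _ ¬> = ⊥-elim (¬> (ℕ.≤-reflexive (sym (proj₁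
          (long-weight (<⇒≢ (ℕ.<-trans p q)) (<⇒≢ q ∘ sym) (<⇒≢ p) ap)))))
  longest-spans {u} {v} {z} (spans-ac p q) ap with ℕ.<-cmp (ε u z) (ε u v)
  ... | tri< _ _ _ = edge-≡ refl refl
  ... | tri≈ ¬< _ _ = ⊥-elim (¬< (ℕ.≤-reflexive (sym (proj₁
          (long-weight (<⇒≢ p) (<⇒≢ q) (<⇒≢ (ℕ.<-trans p q)) ap)))))
  ... | tri> ¬< _ _ = ⊥-elim (¬< (ℕ.≤-reflexive (sym (proj₁
          (long-weight (<⇒≢ p) (<⇒≢ q) (<⇒≢ (ℕ.<-trans p q)) ap)))))
  longest-spans {u} {v} {z} (spans-bc p q) ap with ℕ.<-cmp (ε z u) (ε z v)
  ... | tri≈ _ _ _ = edge-≡ refl refl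
  ... | tri< _ ¬≈ _ = ⊥-elim (¬≈ (trans (ε-sym (<⇒≢ p ∘ sym)) (sym (proj₁
          (short-weight (<⇒≢ p ∘ sym) (<⇒≢ (ℕ.<-trans p q)) (<⇒≢ q) ap)))))
  ... | tri> _ ¬≈ _ = ⊥-elim (¬≈ (trans (ε-sym (<⇒≢ p ∘ sym)) (sym (proj₁
          (short-weight (<⇒≢ p ∘ sym) (<⇒≢ (ℕ.<-trans p q)) (<⇒≢ q) ap)))))

  infixl 6 _+2

  _+2 : Fin n → Fin n
  x +2 = proj₁ (residue (⟦ x ⟧ + + 2))

  +2-≋ : ∀ x → ⟦ x +2 ⟧ ≋ ⟦ x ⟧ + + 2
  +2-≋ x = proj₂ (residue (⟦ x ⟧ + + 2))

  x≢x+2 : ∀ x → x ≢ x +2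
  x≢x+2 x x≡x+2 = pow2-≋̸0 (dbl (unit plus))
    (≋-by -1ℤ (≋-trans (≋-reflexive (cong ⟦_⟧ x≡x+2)) (+2-≋ x)) (identity ⟦ x ⟧))
    where
    identity : ∀ x → + 2 + - 0ℤ ≡ -1ℤ * (x + - (x + + 2))
    identity = solve 1 (λ x → con (+ 2) :+ :- con 0ℤ := con -1ℤ :* (x :+ :- (x :+ con (+ 2)))) refl

  -- The long edges of the progressions with step ±1, which are not faces. Indexing them by the
  -- start `x` yields n codes.
  jump : Fin n → Edge n
  jump x = sortEdge x (x +2) (x≢x+2 x)

  diff-2⇒jump : ∀ {u v} u<v → diff u v ≋ + 2 → jump u ≡ edge u v u<v
  diff-2⇒jump {u} {v} u<v e = sortEdge-< (x≢x+2 u) u<v refl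
    (⟦⟧-injective (≋-trans (+2-≋ u) (≋-by -1ℤ e (identity ⟦ u ⟧ ⟦ v ⟧))))
    where
    identity : ∀ u v → u + + 2 + - v ≡ -1ℤ * (v + - u + - + 2)
    identity = solve 2 (λ u v → u :+ con (+ 2) :+ :- v := con -1ℤ :* ((v :+ :- u) :+ :- con (+ 2))) refl

  diff-−2⇒jump : ∀ {u v} u<v → diff u v ≋ - + 2 → jump v ≡ edge u v u<v
  diff-−2⇒jump {u} {v} u<v e = sortEdge-> (x≢x+2 v) u<v refl
    (⟦⟧-injective (≋-trans (+2-≋ v) (≋-by 1ℤ e (identity ⟦ u ⟧ ⟦ v ⟧))))
    where
    identity : ∀ u v → v + + 2 + - u ≡ 1ℤ * (v + - u + - (- + 2))
    identity = solve 2 (λ u v → v :+ con (+ 2) :+ :- u := con 1ℤ :* ((v :+ :- u) :+ :- con (- + 2))) refl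

  abstract
    midpoint : ∀ u v → ∃ λ z → diff u z ≋ diff z v
    -- With h the inverse of 2, the witness is the residue of h (u + v). The coefficients combine
    -- its reduction with the relation 2 h ≡ 1.
    midpoint u v = proj₁ r , ≋-by₂ (+ 2) (⟦ u ⟧ + ⟦ v ⟧) (proj₂ r) (proj₂ half)
      (identity (proj₁ half) ⟦ u ⟧ ⟦ v ⟧ ⟦ proj₁ r ⟧)
      where
      r : ∃ λ z → ⟦ z ⟧ ≋ proj₁ half * (⟦ u ⟧ + ⟦ v ⟧)
      r = residue (proj₁ half * (⟦ u ⟧ + ⟦ v ⟧))
      identity : ∀ h u v z → z + - u + - (v + - z) ≡ + 2 * (z + - (h * (u + v))) + (u + v) * (+ 2 * h + - 1ℤ)
      identity = solve 4 (λ h u v z → (z :+ :- u) :+ :- (v :+ :- z)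
        := con (+ 2) :* (z :+ :- (h :* (u :+ v))) :+ (u :+ v) :* (con (+ 2) :* h :+ :- con 1ℤ)) refl

  -- Every edge is the long edge of a face or joins some x to x + 2.
  codes : List (Edge n)
  codes = map longest (filterᵇ X allTri) ++ map jump (allFin n)

  jump-coded : ∀ {e} x → jump x ≡ e → e ∈ codes
  jump-coded x refl = ∈-++⁺ʳ (map longest (filterᵇ X allTri)) (∈-map⁺ jump (∈-allFin x))

  longest-coded : ∀ {e} t → X t ≡ true → longest t ≡ e → e ∈ codes
  longest-coded t Xt refl = ∈-++⁺ˡ (∈-map⁺ longest (∈-filter⁺ (T? ∘ X) (allTri-complete t) (≡⇒T Xt)))

  -- The midpoint modulo n completes the edge to a progression. Its step doubles to `diff u v`, so
  -- it is ±1 only if the difference is ±2.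
  long-coded : ∀ {u v} u<v → ¬ diff u v ≋ + 2 → ¬ diff u v ≋ - + 2 → edge u v u<v ∈ codes
  long-coded {u} {v} u<v d≋̸2 d≋̸-2 =
    let t , s = span u<v z≢u z≢v
    in longest-coded t (inX⇒X-spans s (mid-c ap)) (longest-spans s ap)
    where
    z = proj₁ (midpoint u v)
    same : diff u z ≋ diff z v
    same = proj₂ (midpoint u v)
    total : ∀ {x} → diff u z ≋ x → diff u v ≋ + 2 * x
    total {x} e = ≋-by₂ -1ℤ (+ 2) same e (solve 4 (λ u v z x → (v :+ :- u) :+ :- (con (+ 2) :* x)
      := con -1ℤ :* ((z :+ :- u) :+ :- (v :+ :- z)) :+ con (+ 2) :* ((z :+ :- u) :+ :- x)) refl ⟦ u ⟧ ⟦ v ⟧ ⟦ z ⟧ x)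
    z≢u : z ≢ u
    z≢u z≡u = <⇒≢ u<v (diff≋0⇒≡ (total (≋-reflexive (trans (cong (diff u) z≡u) (+-inverseʳ ⟦ u ⟧)))))
    z≢v : z ≢ v
    z≢v z≡v = <⇒≢ u<v (diff≋0⇒≡ (total (≋-trans same
      (≋-reflexive (trans (cong (λ z → diff z v) z≡v) (+-inverseʳ ⟦ v ⟧))))))
    ap : Progression u z v
    ap = progression same (d≋̸2 ∘ total) (d≋̸-2 ∘ total)

  edge-coded : ∀ e → e ∈ codes
  edge-coded (edge u v u<v) = by-cases (diff u v ≋? + 2) (diff u v ≋? - + 2)
    where
    by-cases : Dec (diff u v ≋ + 2) → Dec (diff u v ≋ - + 2) → edge u v u<v ∈ codes
    by-cases (yes d≋2) _ = jump-coded u (diff-2⇒jump u<v d≋2)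
    by-cases (no _) (yes d≋-2) = jump-coded v (diff-−2⇒jump u<v d≋-2)
    by-cases (no d≋̸2) (no d≋̸-2) = long-coded u<v d≋̸2 d≋̸-2

  -- Pigeonhole on `codes`: it covers all edges, and repetitions in it do no harm to an upper bound.
  edges≤faces : n C 2 ℕ.≤ card X ℕ.+ n
  edges≤faces = begin
    n C 2                ≡⟨ length-edges n ⟨
    length (edges n)     ≤⟨ unique-⊆⇒length≤ (edges-unique n) (λ {e} _ → edge-coded e) ⟩
    length codes         ≡⟨ length-++ (map longest (filterᵇ X allTri)) ⟩
    length (map longest (filterᵇ X allTri)) ℕ.+ length (map jump (allFin n))
      ≡⟨ cong₂ ℕ._+_ (trans (length-map longest (filterᵇ X allTri)) (length-filter≡card X))
                     (trans (length-map jump (allFin n)) (length-tabulate {n = n} (λ x → x))) ⟩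
    card X ℕ.+ n    ∎
    where open ℕ.≤-Reasoning

  vertex : ∀ k → k ℕ.< 5 → ∃ λ x → toℕ x ≡ k
  vertex k k<5 = Fin.fromℕ< (ℕ.<-≤-trans k<5 5≤n) , Fin.toℕ-fromℕ< (ℕ.<-≤-trans k<5 5≤n)

  corner-exists : ∃ λ (t : Tri n) → toℕ (Tri.a t) ≡ 0 × toℕ (Tri.b t) ≡ 1 × toℕ (Tri.c t) ≡ 2
  corner-exists
    with x , x≡0 ← vertex 0 (s≤s z≤n)
    with y , y≡1 ← vertex 1 (s≤s (s≤s z≤n))
    with z , z≡2 ← vertex 2 (s≤s (s≤s (s≤s z≤n))) =
    tri x y z (subst₂ ℕ._<_ (sym x≡0) (sym y≡1) (s≤s z≤n))
              (subst₂ ℕ._<_ (sym y≡1) (sym z≡2) (s≤s (s≤s z≤n))) , x≡0 , y≡1 , z≡2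

  -- The three choices of the middle vertex give steps 1, -1 and 2. The first two are excluded, and
  -- the third requires 2 ≡ -1, that is 3 ≡ 0.
  012∉InX : ∀ {a b c} → toℕ a ≡ 0 → toℕ b ≡ 1 → toℕ c ≡ 2 → ¬ InX a b c
  012∉InX a≡0 b≡1 c≡2 (mid-b ap) = Progression.step≋̸1 ap (≋-reflexive
    (cong₂ (λ x y → + y + - + x) a≡0 b≡1))
  012∉InX a≡0 b≡1 c≡2 (mid-a ap) = Progression.step≋̸-1 ap (≋-reflexive
    (cong₂ (λ x y → + y + - + x) b≡1 a≡0))
  012∉InX a≡0 b≡1 c≡2 (mid-c ap) = 1≋̸0 (cancel-3 {1ℤ} {0ℤ} (≋-by {a = + 2} {b = -1ℤ} 1ℤ
    (subst₂ _≋_ (cong₂ (λ x y → + y + - + x) a≡0 c≡2) (cong₂ (λ x y → + y + - + x) c≡2 b≡1)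
      (Progression.steps ap)) refl))

  -- A definite triangle outside `X`, used both to gain one in the upper bound on the number of
  -- faces and to enlarge a supposed hypertree inside `X`.
  corner : Tri n
  corner = proj₁ corner-exists

  corner∉X : X corner ≡ false
  corner∉X =
    let a≡0 , b≡1 , c≡2 = proj₂ corner-exists
    in ¬T⇒≡false λ p → 012∉InX a≡0 b≡1 c≡2 (X⇒inX _ _ _ (Tri.a<b corner) (Tri.b<c corner) (T⇒≡ p))

-- The integers inside the rationals.

module Embedding where
  open import Data.Rational as ℚ using (ℚ; mkℚ; 0ℚ)
  import Data.Rational.Properties as ℚ
  open import Data.Rational.Unnormalised as ℚᵘ using (mkℚᵘ; *≡*)
  import Data.Rational.Unnormalised.Properties as ℚᵘ
  open import Data.Nat.Coprimality using (1-coprimeTo) renaming (sym to coprime-sym)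

  -- `mkℚ` takes the denominator minus one, hence the 0. In this explicit form the integer is
  -- recovered as the numerator.
  ι : ℤ → ℚ
  ι i = mkℚ i 0 (coprime-sym (1-coprimeTo ∣ i ∣))

  ι-injective : ∀ {i j} → ι i ≡ ι j → i ≡ j
  ι-injective = cong ℚ.numerator

  ι-+ : ∀ i j → ι (i + j) ≡ ι i ℚ.+ ι j
  ι-+ i j = ℚ.toℚᵘ-injective (ℚᵘ.≃-trans {mkℚᵘ (i + j) 0} {mkℚᵘ i 0 ℚᵘ.+ mkℚᵘ j 0} (*≡* (identity i j))
    (ℚᵘ.≃-sym (ℚ.toℚᵘ-homo-+ (ι i) (ι j))))
    where
    identity : ∀ i j → (i + j) * 1ℤ ≡ (i * 1ℤ + j * 1ℤ) * 1ℤ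
    identity = solve 2 (λ i j → (i :+ j) :* con 1ℤ := (i :* con 1ℤ :+ j :* con 1ℤ) :* con 1ℤ) refl

  ι-neg : ∀ i → ι (- i) ≡ ℚ.- ι i
  ι-neg i = ℚ.toℚᵘ-injective (ℚᵘ.≃-trans {mkℚᵘ (- i) 0} {ℚᵘ.- mkℚᵘ i 0} ℚᵘ.≃-refl
    (ℚᵘ.≃-sym (ℚ.toℚᵘ-homo‿- (ι i))))

  ι-cyclic-sum : ∀ x y z → ι (x + y + - z) ≡ ι y ℚ.+ (ℚ.- ι z ℚ.+ ι x)
  ι-cyclic-sum x y z = begin
    ι (x + y + - z)                ≡⟨ ι-+ (x + y) (- z) ⟩
    ι (x + y) ℚ.+ ι (- z)          ≡⟨ cong₂ ℚ._+_ (ι-+ x y) (ι-neg z) ⟩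
    ι x ℚ.+ ι y ℚ.+ ℚ.- ι z        ≡⟨ ℚ.+-assoc (ι x) (ι y) (ℚ.- ι z) ⟩
    ι x ℚ.+ (ι y ℚ.+ ℚ.- ι z)      ≡⟨ ℚ.+-comm (ι x) (ι y ℚ.+ ℚ.- ι z) ⟩
    ι y ℚ.+ ℚ.- ι z ℚ.+ ι x        ≡⟨ ℚ.+-assoc (ι y) (ℚ.- ι z) (ι x) ⟩
    ι y ℚ.+ (ℚ.- ι z ℚ.+ ι x)      ∎
    where open ≡-Reasoning

-- Face count, shadow and hypercut.

module Conclusion (m : ℕ) (n-prime : Prime (suc m)) (5≤n : 5 ℕ.≤ suc m)
                  (gen : GeneratedByMinusOneTwo (suc m)) (X : FaceSet {suc m})
                  (X⇒inX : ∀ a b c p q → X (tri a b c p q) ≡ true →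
                           Progressions.InX (suc m) n-prime 5≤n gen a b c)
                  (inX⇒X : ∀ a b c p q → Progressions.InX (suc m) n-prime 5≤n gen a b c →
                           X (tri a b c p q) ≡ true) where
  open Progressions (suc m) n-prime 5≤n gen using (ω; ω-antisym; inX⇒ω-sum; ω-sum⇒inX; <⇒≢)
  open Complex (suc m) n-prime 5≤n gen X X⇒inX inX⇒X
  open import Data.Rational using (ℚ; 0ℚ)
  open import Data.Rational.Properties using (+-*-commutativeRing)
  open Embedding
  open Overℚ
  open module L = Linear {suc m} +-*-commutativeRing

  cocycle : Edge (suc m) → ℚ
  cocycle (edge u v _) = ι (ω u v)

  coboundary-cocycle : ∀ a b c p q →
    coboundary +-*-commutativeRing cocycle (tri a b c p q) ≡ ι (ω a b + ω b c + ω c a)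
  coboundary-cocycle a b c p q = trans (sym (ι-cyclic-sum (ω a b) (ω b c) (ω a c)))
    (cong (λ x → ι (ω a b + ω b c + x)) (sym (proj₂ (ω-antisym (<⇒≢ (ℕ.<-trans p q))))))

  face⇒cocycle : ∀ t → X t ≡ true → coboundary +-*-commutativeRing cocycle t ≡ 0ℚ
  face⇒cocycle (tri a b c p q) Xt = trans (coboundary-cocycle a b c p q)
    (cong ι (inX⇒ω-sum (<⇒≢ p) (<⇒≢ q) (<⇒≢ (ℕ.<-trans p q)) (X⇒inX a b c p q Xt)))

  cocycle⇒face : ∀ t → coboundary +-*-commutativeRing cocycle t ≡ 0ℚ → X t ≡ true
  cocycle⇒face (tri a b c p q) e = inX⇒X a b c p q
    (ω-sum⇒inX (<⇒≢ p) (<⇒≢ q) (<⇒≢ (ℕ.<-trans p q))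
      (ι-injective (trans (sym (coboundary-cocycle a b c p q)) e)))

  -- The common source of the face count, the empty shadow and the hypertrees that witness
  -- minimality of the hypercut.
  insert-independent : ∀ σ → X σ ≡ false → Independent (insert σ X)
  insert-independent σ Xσ = independent-insert {S = X} {σ} cocycle
    (collapsible⇒independent +-*-commutativeRing X-collapsible) face⇒cocycle
    λ e → true≢false (cocycle⇒face σ e) Xσ

  card-X : suc (card X) ≡ m C 2
  card-X = ℕ.≤-antisym upper lower
    where
    open ℕ.≤-Reasoning
    -- The successor is gained by adding `corner`, which keeps the set independent.
    upper : suc (card X) ℕ.≤ m C 2
    upper = subst (ℕ._≤ m C 2) (card-insert X corner corner∉X)
      (rank-bound (insert-independent corner corner∉X))
    -- With n = m + 1, `n C 2` is m + `m C 2`; cancelling m against the n jump codes leaves one.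
    lower : m C 2 ℕ.≤ suc (card X)
    lower = ℕ.+-cancelˡ-≤ m (m C 2) (suc (card X)) (begin
      m ℕ.+ m C 2          ≡⟨ cong (ℕ._+ m C 2) (nC1≡n m) ⟨
      m C 1 ℕ.+ m C 2      ≡⟨ nCk+nC[k+1]≡[n+1]C[k+1] m 1 ⟩
      suc m C 2            ≤⟨ edges≤faces ⟩
      card X ℕ.+ suc m     ≡⟨ ℕ.+-comm (card X) (suc m) ⟩
      suc m ℕ.+ card X     ≡⟨ ℕ.+-suc m (card X) ⟨
      m ℕ.+ suc (card X)   ∎)

  -- The face count was obtained over the rationals but is a statement about numbers only;
  -- independence over `R` comes from the collapse.
  almostHypertree : ∀ {c ℓ} (R : CommutativeRing c ℓ) → Linear.AlmostHypertree R X
  almostHypertree R = independent⇒acyclic R (collapsible⇒independent R X-collapsible) , cong (ℕ._∸ 1) card-X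

  no-shadow : ∀ σ → ¬ InShadow X σ
  no-shadow σ shadow@(Xσ , _) =
    independent-insert⇒¬shadow +-*-commutativeRing (insert-independent σ Xσ) shadow

  -- `insert σ X` has `m C 2` faces and so attains `rank-bound`; no further triangle can be added.
  insert-hypertree : ∀ σ → X σ ≡ false → Hypertree (insert σ X)
  insert-hypertree σ Xσ = independent⇒acyclic +-*-commutativeRing (insert-independent σ Xσ) , maximal
    where
    maximal : ∀ τ → insert σ X τ ≡ false → ¬ Acyclic (insert τ (insert σ X))
    maximal τ ∉ acyclic = ℕ.<-irrefl refl (begin-strict
      m C 2                          <⟨ ℕ.n<1+n _ ⟩
      suc (m C 2)                    ≡⟨ cong suc card-X ⟨
      suc (suc (card X))             ≡⟨ cong suc (card-insert X σ Xσ) ⟨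
      suc (card (insert σ X))        ≡⟨ card-insert (insert σ X) τ ∉ ⟨
      card (insert τ (insert σ X))   ≤⟨ rank-bound (acyclic⇒independent +-*-commutativeRing acyclic) ⟩
      m C 2                          ∎)
      where open ℕ.≤-Reasoning

  -- A hypertree inside X could be enlarged by any triangle outside X.
  complement-meets : MeetsAllHypertrees (complement X)
  complement-meets T (_ , maximal) = [ (λ (t , p) → t , cong not (T⊈X t p) , proj₁ (∧-true⁻ {T t} p))
                                     , (λ none → ⊥-elim (contained λ t Tt → inside t Tt (none t))) ]′
                                     (search (λ t → T t ∧ not (X t)))
    where
    T⊈X : ∀ t → T t ∧ not (X t) ≡ true → X t ≡ false
    T⊈X t p with X t | proj₂ (∧-true⁻ {T t} p)
    ... | false | _ = refl
    inside : ∀ t → T t ≡ true → T t ∧ not (X t) ≡ false → X t ≡ true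
    inside t Tt p with X t
    ... | true = refl
    ... | false rewrite Tt with () ← p
    contained : ¬ T ⊆ X
    contained T⊆X = maximal corner (¬T⇒≡false λ p → true≢false (T⊆X corner (T⇒≡ p)) corner∉X)
      (independent⇒acyclic +-*-commutativeRing
        (independent-⊆ +-*-commutativeRing insert⊆ (insert-independent corner corner∉X)))
      where
      insert⊆ : insert corner T ⊆ insert corner X
      insert⊆ t p = [ (λ q → insert-⊇ X corner t (T⊆X t q)) , (λ where refl → insert-self X corner) ]′
                    (insert⁻ T corner t p)

  -- If `H` omits a triangle `t` outside `X`, it misses the hypertree `insert t X`, whose only face
  -- outside `X` is `t`.
  complement-minimal : ∀ H → H ⊆ complement X → MeetsAllHypertrees H → ∀ t → complement X t ≡ H t
  complement-minimal H H⊆ meets t with X t in Xt | H t in Ht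
  ... | true | false = refl
  ... | false | true = refl
  ... | true | true = ⊥-elim (true≢false (H⊆ t Ht) (cong not Xt))
  ... | false | false = ⊥-elim (impossible (meets (insert t X) (insert-hypertree t Xt)))
    where
    impossible : ¬ Meets H (insert t X)
    impossible (s , Hs , p) = [ (λ Xs → true≢false (H⊆ s Hs) (cong not Xs))
                              , (λ where refl → true≢false Hs Ht) ]′ (insert⁻ X t s p)

  -- By Pascal's rule the complement has `m C 3` + 1 faces; the last steps rewrite this with the
  -- truncated subtraction of `PerfectHypercut`.
  card-complement-X : card (complement X) ≡ suc m C 3 ℕ.∸ m C 2 ℕ.+ 1
  card-complement-X = ℕ.+-cancelˡ-≡ (card X) _ _ (begin
    card X ℕ.+ card (complement X)               ≡⟨ card-complement X ⟩
    length (allTri {suc m})                      ≡⟨ length-allTri (suc m) ⟩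
    suc m C 3                                    ≡⟨ pascal ⟨
    m C 2 ℕ.+ m C 3                              ≡⟨ cong (ℕ._+ m C 3) card-X ⟨
    suc (card X) ℕ.+ m C 3                       ≡⟨ ℕ.+-suc (card X) (m C 3) ⟨
    card X ℕ.+ suc (m C 3)                       ≡⟨ cong (card X ℕ.+_) (ℕ.+-comm 1 (m C 3)) ⟩
    card X ℕ.+ (m C 3 ℕ.+ 1)                     ≡⟨ cong (λ k → card X ℕ.+ (k ℕ.+ 1)) (ℕ.m+n∸m≡n (m C 2) (m C 3)) ⟨
    card X ℕ.+ (m C 2 ℕ.+ m C 3 ℕ.∸ m C 2 ℕ.+ 1) ≡⟨ cong (λ k → card X ℕ.+ (k ℕ.∸ m C 2 ℕ.+ 1)) pascal ⟩
    card X ℕ.+ (suc m C 3 ℕ.∸ m C 2 ℕ.+ 1)       ∎)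
    where
    open ≡-Reasoning
    pascal : m C 2 ℕ.+ m C 3 ≡ suc m C 3
    pascal = nCk+nC[k+1]≡[n+1]C[k+1] m 2

  complement-perfect : PerfectHypercut (complement X)
  complement-perfect = (complement-meets , complement-minimal) , card-complement-X

theorem1 : ∀ {c ℓ : Level} (n : ℕ) .{{_ : NonZero n}} → Prime n → 5 ≤ n →
    GeneratedByMinusOneTwo n →
    (Collapsible (Xn n)
    × ((F : Field c ℓ) → Linear.AlmostHypertree (Field.commutativeRing F) (Xn n)))
    × ((∀ σ → ¬ Linear.InShadow +-*-commutativeRing (Xn n) σ)
    × Linear.PerfectHypercut +-*-commutativeRing (complement (Xn n)))
theorem1 (suc m) n-prime 5≤n gen =
  (X-collapsible , λ F → almostHypertree (Field.commutativeRing F)) , no-shadow , complement-perfect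
  where
  open Progressions (suc m) n-prime 5≤n gen using (Xn⇒inX; inX⇒Xn)
  open Complex (suc m) n-prime 5≤n gen (Xn (suc m)) Xn⇒inX inX⇒Xn using (X-collapsible)
  open Conclusion m n-prime 5≤n gen (Xn (suc m)) Xn⇒inX inX⇒Xn
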